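{- Let $h\ge 2$ be an integer and let $O$ be a finite set of next hops with $\delta=|O|$ and probability distribution $(p_o)_{o\in O}$, with entropy $H_O=\sum_{o\in O} p_o\log_2\frac{1}{p_o}$. Let $T$ be the complete binary trie of height $h$ whose $2^h$ leaves are labeled independently with next hop $o$ with probability $p_o$, let $D$ be the DAG obtained from $T$ by trie-folding, and let $V^j_D$ be the set of nodes of $D$ at level $j$. For $1\le j\le h$ put $\beta_j=\min\{\frac{H_O}{h-j}2^h+3,\,2^{h-j},\,\delta^{2^j}\}$ (with the first term $+\infty$ for $j=h$), let $k^*\in\{1,\dots,h\}$ be a level at which $\beta_j$ attains its maximum, and suppose each node of $D$ is stored using $2(h-k^*)$ bits. Then the expected number of bits needed to store the nodes of $D$ (at levels $1,\dots,h$), namely $2(h-k^*)\sum_{j=1}^h E(|V^j_D|)$, is at most \[2 h H_O 2^{h} + 6h^2.\]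
   Context: Levels: the level of a node of $T$ is $h$ minus its distance from the root; the root has level $h$, leaves level $0$, and level $j$ has $2^{h-j}$ nodes, each the root of a subtrie of height $j$ with $2^j$ labeled leaves. Trie-folding merges nodes whose rooted subtries are identical (same structure and same leaf next-hop labels), producing a DAG $D$; the nodes of $D$ at level $j$ correspond to the distinct leaf-label strings of length $2^j$ among the $2^{h-j}$ level-$j$ subtries. Each node of $D$ stores two child pointers of $h-k^*$ bits each. -}

module Defs where

open import Algebra.Bundles using (CommutativeRing; Semiring)
import Algebra.Construct.NaturalChoice.Min as Min
import Algebra.Definitions.RawSemiring as RawSemiringDefs
open import Data.Fin.Base using (Fin; suc; toℕ)
import Data.Fin.Properties as Fin
open import Data.List.Base
  using (List; []; _∷_; _++_; map; foldr; length; lookup; allFin; cartesianProductWith; deduplicate)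
open import Data.List.Membership.Propositional using (_∈_)
open import Data.List.Membership.Propositional.Properties
  using (∈-++⁺ˡ; ∈-++⁺ʳ; ∈-++⁻; ∈-deduplicate⁺; ∈-deduplicate⁻; ∈-lookup)
open import Data.List.Relation.Unary.Any using (here; index)
open import Data.Nat.Base as ℕ using (ℕ; zero; suc)
import Data.Nat.Properties as ℕ
open import Data.Product.Base using (∃; ∃-syntax; _×_; _,_; proj₁; proj₂)
open import Data.Sum.Base using (inj₁; inj₂)
open import Function.Base using (_∘_)
open import Level using (0ℓ) renaming (suc to lsuc)
open import Relation.Binary.Bundles using (DecTotalOrder; StrictTotalOrder)
open import Relation.Binary.Core using (Rel)
open import Relation.Binary.Definitions using (DecidableEquality)
open import Relation.Binary.PropositionalEquality using (_≡_; refl; cong₂)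
import Relation.Binary.Properties.StrictTotalOrder as STOProperties
open import Relation.Binary.Structures using (IsStrictTotalOrder)
open import Relation.Nullary using (yes; no)
open import Relation.Unary using (Pred)

------------------------------------------------------------------------
-- Real numbers

-- The real numbers are given by the axioms of a Dedekind-complete ordered
-- field, which determine them up to isomorphism. As in classical
-- mathematics the order is trichotomous. The total operations _⁻¹ and ⨆
-- are constrained only where the inverse, resp. the supremum, exists.
record Reals : Set (lsuc 0ℓ) where
  field
    commutativeRing : CommutativeRing 0ℓ 0ℓ

  open CommutativeRing commutativeRing public

  infix  4 _<_
  infix  8 _⁻¹

  field
    _<_                : Rel Carrier 0ℓ
    isStrictTotalOrder : IsStrictTotalOrder _≈_ _<_
    0≉1                : 0# ≉ 1#
    +-monoˡ-<          : ∀ x {y z} → y < z → y + x < z + x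
    *-pos              : ∀ {x y} → 0# < x → 0# < y → 0# < x * y
    _⁻¹                : Carrier → Carrier
    *-inverseʳ         : ∀ {x} → x ≉ 0# → x * x ⁻¹ ≈ 1#

  strictTotalOrder : StrictTotalOrder 0ℓ 0ℓ 0ℓ
  strictTotalOrder = record { isStrictTotalOrder = isStrictTotalOrder }

  decTotalOrder : DecTotalOrder 0ℓ 0ℓ 0ℓ
  decTotalOrder = STOProperties.decTotalOrder strictTotalOrder

  open DecTotalOrder decTotalOrder public using (_≤_; totalOrder)
  open Min totalOrder public using (_⊓_)
  open RawSemiringDefs (Semiring.rawSemiring semiring) public using (_^_; sum) renaming (_×_ to _·_)

  UpperBound : Pred Carrier 0ℓ → Pred Carrier 0ℓ
  UpperBound P u = ∀ x → P x → x ≤ u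

  IsSupremum : Pred Carrier 0ℓ → Pred Carrier 0ℓ
  IsSupremum P s = UpperBound P s × (∀ u → UpperBound P u → s ≤ u)

  field
    ⨆            : Pred Carrier 0ℓ → Carrier
    ⨆-isSupremum : ∀ P → ∃ P → ∃ (UpperBound P) → IsSupremum P (⨆ P)

  ι : ℕ → Carrier
  ι n = n · 1#

  -- The fractions q = (a - c) / (b + 1) with 2 ^ q ≤ x, the inequality
  -- being raised to the power b + 1 and multiplied by 2 ^ c.
  BelowLog₂ : Carrier → Pred Carrier 0ℓ
  BelowLog₂ x q = ∃[ a ] ∃[ b ] ∃[ c ]
    (q * ι (suc b) ≈ ι a - ι c) × (ι 2 ^ a ≤ x ^ suc b * ι 2 ^ c)

  -- Meaningful for 0# < x only.
  log₂ : Carrier → Carrier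
  log₂ x = ⨆ (BelowLog₂ x)

------------------------------------------------------------------------
-- Leaf-labelled complete binary tries, indexed by height

data Trie (A : Set) : ℕ → Set where
  leaf : A → Trie A zero
  node : ∀ {h} → Trie A h → Trie A h → Trie A (suc h)

module _ {A : Set} (_≟ᴬ_ : DecidableEquality A) where

  infix 4 _≟_

  _≟_ : ∀ {h} → DecidableEquality (Trie A h)
  leaf a ≟ leaf b with a ≟ᴬ b
  ... | yes refl = yes refl
  ... | no a≢b   = no λ { refl → a≢b refl }
  node l r ≟ node l′ r′ with l ≟ l′ | r ≟ r′
  ... | yes refl | yes refl = yes refl
  ... | no l≢l′  | _        = no λ { refl → l≢l′ refl }
  ... | yes _    | no r≢r′  = no λ { refl → r≢r′ refl }

module _ {A : Set} where

  self : ∀ {h} j → Trie A h → List (Trie A j)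
  self {h} j t with h ℕ.≟ j
  ... | yes refl = t ∷ []
  ... | no _     = []

  -- The subtries rooted at the level-j nodes, one entry for every node.
  mutual
    subtries : ∀ {h} j → Trie A h → List (Trie A j)
    subtries j t = self j t ++ properSubtries j t

    properSubtries : ∀ {h} j → Trie A h → List (Trie A j)
    properSubtries j (leaf _)   = []
    properSubtries j (node l r) = subtries j l ++ subtries j r

  self-∈ : ∀ {h} (t : Trie A h) → t ∈ subtries h t
  self-∈ {h} t with h ℕ.≟ h
  ... | yes refl = here refl
  ... | no h≢h   with () ← h≢h refl

  children-∈ : ∀ {h j} (t : Trie A h) {l r : Trie A j} →
               node l r ∈ subtries (suc j) t → l ∈ subtries j t × r ∈ subtries j t
  children-∈ {h} {j} t p with ∈-++⁻ (self (suc j) t) p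
  children-∈ {h} {j} t p | inj₁ q with h ℕ.≟ suc j
  children-∈ {h} {j} t@(node l r) p | inj₁ (here refl) | yes refl =
    ∈-++⁺ʳ (self j t) (∈-++⁺ˡ (self-∈ l)) ,
    ∈-++⁺ʳ (self j t) (∈-++⁺ʳ (subtries j l) (self-∈ r))
  children-∈ {h} {j} t@(node l r) p | inj₂ q with ∈-++⁻ (subtries (suc j) l) q
  ... | inj₁ q′ = let (x , y) = children-∈ l q′ in
    ∈-++⁺ʳ (self j t) (∈-++⁺ˡ x) , ∈-++⁺ʳ (self j t) (∈-++⁺ˡ y)
  ... | inj₂ q′ = let (x , y) = children-∈ r q′ in
    ∈-++⁺ʳ (self j t) (∈-++⁺ʳ (subtries j l) x) , ∈-++⁺ʳ (self j t) (∈-++⁺ʳ (subtries j l) y)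

------------------------------------------------------------------------
-- Trie-folding

-- A rooted DAG with h + 1 levels; its nodes at level j are
-- Fin (width j), and both children of a node lie one level below it.
record DAG (A : Set) (h : ℕ) : Set where
  field
    width      : ℕ → ℕ
    root       : Fin (width h)
    left right : ∀ {j} → Fin (width (suc j)) → Fin (width j)
    label      : Fin (width zero) → A

module _ {A : Set} (_≟ᴬ_ : DecidableEquality A) {h : ℕ} (t : Trie A h) where

  private
    distinct : ∀ j → List (Trie A j)
    distinct j = deduplicate (_≟_ _≟ᴬ_) (subtries j t)

    child : ∀ {j} → (∀ {l r : Trie A j} → l ∈ subtries j t × r ∈ subtries j t →
                     ∃[ s ] s ∈ subtries j t) →
            Fin (length (distinct (suc j))) → Fin (length (distinct j))
    child {j} pick i with lookup (distinct (suc j)) i | ∈-lookup {xs = distinct (suc j)} i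
    ... | node l r | p = index (∈-deduplicate⁺ (_≟_ _≟ᴬ_) (proj₂ (pick
      (children-∈ t (∈-deduplicate⁻ (_≟_ _≟ᴬ_) (subtries (suc j) t) p)))))

    value : Trie A zero → A
    value (leaf a) = a

  fold : DAG A h
  fold = record
    { width = length ∘ distinct
    ; root  = index (∈-deduplicate⁺ (_≟_ _≟ᴬ_) (self-∈ t))
    ; left  = child (λ (l∈ , _) → _ , l∈)
    ; right = child (λ (_ , r∈) → _ , r∈)
    ; label = value ∘ lookup (distinct zero)
    }

-- Two pointers of the given size at every node of the levels 1, …, h.
storageBits : ∀ {A h} → DAG A h → ℕ → ℕ
storageBits {h = h} D pointerBits =
  foldr ℕ._+_ 0 (map (λ i → DAG.width D (suc (toℕ i)) ℕ.* (2 ℕ.* pointerBits)) (allFin h))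

------------------------------------------------------------------------
-- Random tries

module Random (ℝ : Reals) {δ : ℕ} (p : Fin δ → Reals.Carrier ℝ) where

  open Reals ℝ

  record IsDistribution : Set where
    field
      nonNegative : ∀ o → 0# ≤ p o
      sum≈1       : sum p ≈ 1#

  -- If p o ≈ 0# the summand is zero, whatever the value of log₂ (p o ⁻¹).
  entropy : Carrier
  entropy = sum λ o → p o * log₂ (p o ⁻¹)

  allTries : ∀ h → List (Trie (Fin δ) h)
  allTries zero    = map leaf (allFin δ)
  allTries (suc h) = cartesianProductWith node (allTries h) (allTries h)

  probability : ∀ {h} → Trie (Fin δ) h → Carrier
  probability (leaf o)   = p o
  probability (node l r) = probability l * probability r

  𝔼 : ∀ {h} → (Trie (Fin δ) h → Carrier) → Carrier
  𝔼 {h} X = foldr _+_ 0# (map (λ t → probability t * X t) (allTries h))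

  foldTrie : ∀ {h} → Trie (Fin δ) h → DAG (Fin δ) h
  foldTrie = fold Fin._≟_

  expectedWidth : ℕ → ℕ → Carrier
  expectedWidth h j = 𝔼 {h} λ t → ι (DAG.width (foldTrie t) j)

  expectedStorage : ℕ → ℕ → Carrier
  expectedStorage h pointerBits = 𝔼 {h} λ t → ι (storageBits (foldTrie t) pointerBits)

  β : ℕ → ℕ → Carrier
  β h j = entropyCap (h ℕ.∸ j) (ι (2 ℕ.^ (h ℕ.∸ j)) ⊓ ι (δ ℕ.^ (2 ℕ.^ j)))
    where
    -- For j = h the entropy term is +∞ and drops out of the minimum.
    entropyCap : ℕ → Carrier → Carrier
    entropyCap zero      m = m
    entropyCap n@(suc _) m = (entropy * ι n ⁻¹ * ι (2 ℕ.^ h) + ι 3) ⊓ m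

{-# OPTIONS --safe #-}

-- The level-j subtries are 2ᵈ independent random labellings, d = h - j, so a
-- labelling s of probability q occurs among them with probability at most
-- w = min (1, 2ᵈ q), and E|Vʲ| is at most the sum of w over all s. Pointwise
--   d w ≤ 2ᵈ q log₂ (1/q) + 2 d q :
-- for q > 1/2 the last term suffices, and for q ≤ 1/2 put x = 1/q ≥ 2; then
-- either x ≥ 2ᵈ, or d x ≤ 2ᵈ log₂ x because log₂ lies above its chords
-- between consecutive powers of 2. Summing over s bounds E|Vʲ| by
-- H 2ʰ / d + 2, since the entropy of a subtrie is 2ʲ H. Hence E|Vʲ| ≤ βⱼ, and
-- 2 (h - k) ∑ⱼ E|Vʲ| ≤ 2 (h - k) h βₖ with βₖ ≤ H 2ʰ / (h - k) + 3.

module Submission where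

open import Defs
open import Data.Bool.Base using (true; false)
open import Data.Empty using (⊥-elim)
open import Data.Fin.Base using (Fin; toℕ)
import Data.Fin.Properties as Fin
open import Data.List.Base
  using (List; []; _∷_; _++_; map; foldr; length; filter; allFin; tabulate; cartesianProductWith; deduplicate)
open import Data.List.Membership.Propositional using (_∈_)
open import Data.List.Membership.Propositional.Properties
  using (∈-map⁺; ∈-allFin; ∈-cartesianProductWith⁺)
import Data.List.Properties as List
open import Data.List.Relation.Unary.All using (All; []; _∷_)
open import Data.List.Relation.Unary.AllPairs using ([]; _∷_)
open import Data.List.Relation.Unary.Any using (here; there)
open import Data.List.Relation.Unary.Unique.DecPropositional.Properties using (deduplicate-!)
open import Data.List.Relation.Unary.Unique.Propositional using (Unique)
open import Data.List.Relation.Unary.Unique.Propositional.Properties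
  using (map⁺; allFin⁺; cartesianProductWith⁺)
open import Data.Nat.Base as ℕ using (ℕ; zero; suc; z≤n; s≤s)
import Data.Nat.DivMod as ℕ
import Data.Nat.Properties as ℕ
open import Data.Product.Base using (_×_; _,_; proj₁; proj₂; ∃-syntax)
open import Data.Sum.Base using (_⊎_; inj₁; inj₂)
open import Function.Base using (id; _∘_)
open import Level using (0ℓ)
open import Relation.Binary.Bundles using (DecTotalOrder; StrictTotalOrder)
open import Relation.Binary.Definitions using (DecidableEquality; tri<; tri≈; tri>)
open import Relation.Binary.PropositionalEquality as ≡ using (_≡_)
open import Relation.Nullary using (¬_; yes; no; does)
open import Relation.Unary using (Pred; Decidable)

-- Large q needs its own term because log₂ vanishes at 1: for d > 0 the inequality d x ≤ 2ᵈ log₂ x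
-- fails for x near 1, and x = 2 is the first power of 2 from which it can start. The correction is
-- cheap, as 2 d q sums to 2 d over all labellings. Its inequalities are therefore proved for powers
-- of order 2ᵏ: rounding an exponent to an integer costs a bounded amount there, and this cost
-- disappears on division by 2ᵏ as k grows. For products, log₂ (x y) ≤ log₂ x + log₂ y is enough:
-- log₂ (1/q) only has to stay below the sum of the leaf terms, since that sum, whose mean is the
-- entropy of the subtrie, appears in upper bounds alone.

n<2^n : ∀ n → n ℕ.< 2 ℕ.^ n
n<2^n zero    = s≤s z≤n
n<2^n (suc n) = begin
  suc (suc n)             ≡⟨ ≡.cong suc (ℕ.+-comm 1 n) ⟩
  suc n ℕ.+ 1             ≤⟨ ℕ.+-mono-≤ (n<2^n n) (ℕ.m^n>0 2 n) ⟩
  2 ℕ.^ n ℕ.+ 2 ℕ.^ n     ≡⟨ ≡.cong (2 ℕ.^ n ℕ.+_) (ℕ.+-identityʳ _) ⟨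
  2 ℕ.^ suc n             ∎
  where open ℕ.≤-Reasoning

-- Ordered-field arithmetic and the Archimedean property

module RealProperties (ℝ : Reals) where

  open Reals ℝ
  open import Algebra.Properties.CommutativeSemiring.Exp commutativeSemiring public
    using (^-congˡ; ^-homo-*; ^-assocʳ; ^-distrib-*)
  import Algebra.Properties.Group +-group as +-Group
  import Algebra.Properties.Ring ring as Ring
  open import Algebra.Properties.Semiring.Mult semiring using (×-homo-+; ×1-homo-*)
  open import Algebra.Solver.Ring.NaturalCoefficients.Default commutativeSemiring
    using (solve; con; _:=_; _:+_; _:*_)
  open StrictTotalOrder strictTotalOrder using (compare; strictPartialOrder)
    renaming (trans to <-trans; irrefl to <-irrefl)
  open DecTotalOrder decTotalOrder public using (_≤?_)
    renaming (refl to ≤-refl; trans to ≤-trans; reflexive to ≤-reflexive)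
  open import Relation.Binary.Reasoning.StrictPartialOrder strictPartialOrder public

  <⇒≱ : ∀ {x y} → x < y → ¬ (y ≤ x)
  <⇒≱ x<y (inj₁ y<x) = <-irrefl refl (<-trans x<y y<x)
  <⇒≱ x<y (inj₂ y≈x) = <-irrefl (sym y≈x) x<y

  ≰⇒> : ∀ {x y} → ¬ (x ≤ y) → y < x
  ≰⇒> {x} {y} x≰y with compare x y
  ... | tri< x<y _ _ = ⊥-elim (x≰y (inj₁ x<y))
  ... | tri≈ _ x≈y _ = ⊥-elim (x≰y (inj₂ x≈y))
  ... | tri> _ _ y<x = y<x

  ≮⇒≥ : ∀ {x y} → ¬ (x < y) → y ≤ x
  ≮⇒≥ {x} {y} x≮y with compare x y
  ... | tri< x<y _ _ = ⊥-elim (x≮y x<y)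
  ... | tri≈ _ x≈y _ = inj₂ (sym x≈y)
  ... | tri> _ _ y<x = inj₁ y<x

  ≤-stable : ∀ {x y} → ¬ ¬ (x ≤ y) → x ≤ y
  ≤-stable ¬¬x≤y = ≮⇒≥ λ y<x → ¬¬x≤y (<⇒≱ y<x)

  +-monoˡ-≤ : ∀ x {y z} → y ≤ z → y + x ≤ z + x
  +-monoˡ-≤ x (inj₁ y<z) = inj₁ (+-monoˡ-< x y<z)
  +-monoˡ-≤ x (inj₂ y≈z) = inj₂ (+-congʳ y≈z)

  +-monoʳ-≤ : ∀ x {y z} → y ≤ z → x + y ≤ x + z
  +-monoʳ-≤ x {y} {z} y≤z = begin
    x + y ≈⟨ +-comm x y ⟩
    y + x ≤⟨ +-monoˡ-≤ x y≤z ⟩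
    z + x ≈⟨ +-comm z x ⟩
    x + z ∎

  +-mono-≤ : ∀ {x y u v} → x ≤ y → u ≤ v → x + u ≤ y + v
  +-mono-≤ {y = y} {u} x≤y u≤v = ≤-trans (+-monoˡ-≤ u x≤y) (+-monoʳ-≤ y u≤v)

  x+y-y≈x : ∀ x y → x + y - y ≈ x
  x+y-y≈x x y = trans (+-assoc x y (- y)) (trans (+-congˡ (-‿inverseʳ y)) (+-identityʳ x))

  x-y+y≈x : ∀ x y → x - y + y ≈ x
  x-y+y≈x x y = trans (+-assoc x (- y) y) (trans (+-congˡ (-‿inverseˡ y)) (+-identityʳ x))

  +-cancelʳ-≤ : ∀ z {x y} → x + z ≤ y + z → x ≤ y
  +-cancelʳ-≤ z {x} {y} x+z≤y+z = begin
    x           ≈⟨ x+y-y≈x x z ⟨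
    x + z - z   ≤⟨ +-monoˡ-≤ (- z) x+z≤y+z ⟩
    y + z - z   ≈⟨ x+y-y≈x y z ⟩
    y           ∎

  0<y-x : ∀ {x y} → x < y → 0# < y - x
  0<y-x {x} {y} x<y = begin-strict
    0#    ≈⟨ -‿inverseʳ x ⟨
    x - x <⟨ +-monoˡ-< (- x) x<y ⟩
    y - x ∎

  *-monoʳ-< : ∀ {x y z} → 0# < x → y < z → x * y < x * z
  *-monoʳ-< {x} {y} {z} 0<x y<z = begin-strict
    x * y               ≈⟨ +-identityˡ _ ⟨
    0# + x * y          <⟨ +-monoˡ-< (x * y) (*-pos 0<x (0<y-x y<z)) ⟩
    x * (z - y) + x * y ≈⟨ distribˡ x (z - y) y ⟨
    x * (z - y + y)     ≈⟨ *-congˡ (x-y+y≈x z y) ⟩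
    x * z               ∎

  *-monoʳ-≤ : ∀ {x y z} → 0# ≤ x → y ≤ z → x * y ≤ x * z
  *-monoʳ-≤ 0≤x        (inj₂ y≈z) = inj₂ (*-congˡ y≈z)
  *-monoʳ-≤ (inj₁ 0<x) (inj₁ y<z) = inj₁ (*-monoʳ-< 0<x y<z)
  *-monoʳ-≤ {x} {y} {z} (inj₂ 0≈x) (inj₁ y<z) = inj₂
    (trans (*-congʳ (sym 0≈x)) (trans (zeroˡ y) (sym (trans (*-congʳ (sym 0≈x)) (zeroˡ z)))))

  *-monoˡ-≤ : ∀ {x y z} → 0# ≤ x → y ≤ z → y * x ≤ z * x
  *-monoˡ-≤ {x} {y} {z} 0≤x y≤z = begin
    y * x ≈⟨ *-comm y x ⟩
    x * y ≤⟨ *-monoʳ-≤ 0≤x y≤z ⟩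
    x * z ≈⟨ *-comm x z ⟩
    z * x ∎

  *-mono-≤ : ∀ {x y u v} → 0# ≤ y → 0# ≤ u → x ≤ y → u ≤ v → x * u ≤ y * v
  *-mono-≤ 0≤y 0≤u x≤y u≤v = ≤-trans (*-monoˡ-≤ 0≤u x≤y) (*-monoʳ-≤ 0≤y u≤v)

  *-cancelˡ-≤ : ∀ {x y z} → 0# < x → x * y ≤ x * z → y ≤ z
  *-cancelˡ-≤ 0<x xy≤xz = ≮⇒≥ λ z<y → <⇒≱ (*-monoʳ-< 0<x z<y) xy≤xz

  *-nonNeg : ∀ {x y} → 0# ≤ x → 0# ≤ y → 0# ≤ x * y
  *-nonNeg {x} 0≤x 0≤y = ≤-trans (inj₂ (sym (zeroʳ x))) (*-monoʳ-≤ 0≤x 0≤y)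

  +-nonNeg : ∀ {x y} → 0# ≤ x → 0# ≤ y → 0# ≤ x + y
  +-nonNeg 0≤x 0≤y = ≤-trans (inj₂ (sym (+-identityˡ 0#))) (+-mono-≤ 0≤x 0≤y)

  x≤x+y : ∀ {x y} → 0# ≤ y → x ≤ x + y
  x≤x+y {x} 0≤y = ≤-trans (inj₂ (sym (+-identityʳ x))) (+-monoʳ-≤ x 0≤y)

  0<1 : 0# < 1#
  0<1 = ≰⇒> λ
    { (inj₁ 1<0) → <⇒≱ 1<0 (inj₁ (begin-strict
        0#           <⟨ *-pos (0<-1 1<0) (0<-1 1<0) ⟩
        - 1# * - 1#  ≈⟨ Ring.-1*x≈-x (- 1#) ⟩
        - - 1#       ≈⟨ +-Group.⁻¹-involutive 1# ⟩
        1#           ∎))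
    ; (inj₂ 1≈0) → 0≉1 (sym 1≈0) }
    where
    0<-1 : 1# < 0# → 0# < - 1#
    0<-1 1<0 = begin-strict
      0#         <⟨ 0<y-x 1<0 ⟩
      0# - 1#    ≈⟨ +-identityˡ _ ⟩
      - 1#       ∎

  0≤1 : 0# ≤ 1#
  0≤1 = inj₁ 0<1

  x*x⁻¹≈1 : ∀ {x} → 0# < x → x * x ⁻¹ ≈ 1#
  x*x⁻¹≈1 0<x = *-inverseʳ λ x≈0 → <-irrefl (sym x≈0) 0<x

  1≤x⁻¹ : ∀ {x} → 0# < x → x ≤ 1# → 1# ≤ x ⁻¹
  1≤x⁻¹ {x} 0<x x≤1 = *-cancelˡ-≤ 0<x (begin
    x * 1#   ≈⟨ *-identityʳ x ⟩
    x        ≤⟨ x≤1 ⟩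
    1#       ≈⟨ x*x⁻¹≈1 0<x ⟨
    x * x ⁻¹ ∎)

  0≤ι : ∀ n → 0# ≤ ι n
  0≤ι zero    = ≤-refl
  0≤ι (suc n) = +-nonNeg 0≤1 (0≤ι n)

  0<ι : ∀ n → 0# < ι (suc n)
  0<ι n = begin-strict
    0#        <⟨ 0<1 ⟩
    1#        ≤⟨ x≤x+y (0≤ι n) ⟩
    ι (suc n) ∎

  ι-mono : ∀ {m n} → m ℕ.≤ n → ι m ≤ ι n
  ι-mono {n = n} z≤n = 0≤ι n
  ι-mono (s≤s m≤n)   = +-monoʳ-≤ 1# (ι-mono m≤n)

  ι-+ : ∀ m n → ι (m ℕ.+ n) ≈ ι m + ι n
  ι-+ = ×-homo-+ 1#

  ι-* : ∀ m n → ι (m ℕ.* n) ≈ ι m * ι n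
  ι-* = ×1-homo-*

  ι-^ : ∀ m n → ι (m ℕ.^ n) ≈ ι m ^ n
  ι-^ m zero    = +-identityʳ 1#
  ι-^ m (suc n) = trans (ι-* m (m ℕ.^ n)) (*-congˡ (ι-^ m n))

  0≤2 : 0# ≤ ι 2
  0≤2 = 0≤ι 2

  1<2 : 1# < ι 2
  1<2 = begin-strict
    1#      ≈⟨ +-identityʳ 1# ⟨
    ι 1     ≈⟨ +-identityˡ (ι 1) ⟨
    0# + ι 1 <⟨ +-monoˡ-< (ι 1) 0<1 ⟩
    ι 2     ∎

  1≤2 : 1# ≤ ι 2
  1≤2 = inj₁ 1<2

  ^-nonNeg : ∀ {x} n → 0# ≤ x → 0# ≤ x ^ n
  ^-nonNeg zero    0≤x = 0≤1
  ^-nonNeg (suc n) 0≤x = *-nonNeg 0≤x (^-nonNeg n 0≤x)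

  ^-pos : ∀ {x} n → 0# < x → 0# < x ^ n
  ^-pos zero    0<x = 0<1
  ^-pos (suc n) 0<x = *-pos 0<x (^-pos n 0<x)

  ^-monoˡ-≤ : ∀ {x y} n → 0# ≤ x → x ≤ y → x ^ n ≤ y ^ n
  ^-monoˡ-≤ zero    0≤x x≤y = ≤-refl
  ^-monoˡ-≤ (suc n) 0≤x x≤y =
    *-mono-≤ (≤-trans 0≤x x≤y) (^-nonNeg n 0≤x) x≤y (^-monoˡ-≤ n 0≤x x≤y)

  ^-monoˡ-< : ∀ {x y} n → 0# < x → x < y → x ^ suc n < y ^ suc n
  ^-monoˡ-< {x} {y} n 0<x x<y = begin-strict
    x * x ^ n ≈⟨ *-comm x (x ^ n) ⟩
    x ^ n * x <⟨ *-monoʳ-< (^-pos n 0<x) x<y ⟩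
    x ^ n * y ≤⟨ *-monoˡ-≤ (inj₁ (<-trans 0<x x<y)) (^-monoˡ-≤ n (inj₁ 0<x) (inj₁ x<y)) ⟩
    y ^ n * y ≈⟨ *-comm (y ^ n) y ⟩
    y * y ^ n ∎

  ^-cancelʳ-≤ : ∀ {x y} n → 0# < y → x ^ suc n ≤ y ^ suc n → x ≤ y
  ^-cancelʳ-≤ n 0<y xⁿ≤yⁿ = ≮⇒≥ λ y<x → <⇒≱ (^-monoˡ-< n 0<y y<x) xⁿ≤yⁿ

  1≤x^n : ∀ {x} n → 1# ≤ x → 1# ≤ x ^ n
  1≤x^n zero    1≤x = ≤-refl
  1≤x^n {x} (suc n) 1≤x = begin
    1#        ≈⟨ *-identityˡ 1# ⟨
    1# * 1#   ≤⟨ *-mono-≤ (≤-trans 0≤1 1≤x) 0≤1 1≤x (1≤x^n n 1≤x) ⟩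
    x * x ^ n ∎

  ^-monoʳ-≤ : ∀ {x m n} → 1# ≤ x → m ℕ.≤ n → x ^ m ≤ x ^ n
  ^-monoʳ-≤ {n = n} 1≤x z≤n   = 1≤x^n n 1≤x
  ^-monoʳ-≤ 1≤x (s≤s m≤n)     = *-monoʳ-≤ (≤-trans 0≤1 1≤x) (^-monoʳ-≤ 1≤x m≤n)

  ι≤2^ : ∀ n → ι n ≤ ι 2 ^ n
  ι≤2^ n = ≤-trans (ι-mono (ℕ.<⇒≤ (n<2^n n))) (≤-reflexive (ι-^ 2 n))

  2^-cancel-≤ : ∀ {m n} → ι 2 ^ m ≤ ι 2 ^ n → m ℕ.≤ n
  2^-cancel-≤ {m} {n} 2ᵐ≤2ⁿ = ℕ.≮⇒≥ λ n<m → <⇒≱ (begin-strict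
    ι 2 ^ n         ≈⟨ *-identityʳ _ ⟨
    ι 2 ^ n * 1#    <⟨ *-monoʳ-< (^-pos n (0<ι 1)) 1<2 ⟩
    ι 2 ^ n * ι 2   ≈⟨ *-comm _ (ι 2) ⟩
    ι 2 ^ suc n     ≤⟨ ^-monoʳ-≤ 1≤2 n<m ⟩
    ι 2 ^ m         ∎) 2ᵐ≤2ⁿ

  -- If s were the supremum of the natural numbers, then n + 1 ≤ s for every n would make s - 1 a
  -- smaller upper bound. The conclusion is a bare negation: no particular n above `x` is produced.
  archimedean : ∀ x → ¬ (∀ n → ι n ≤ x)
  archimedean x ι≤x = <⇒≱ s-1<s (proj₂ isSup (s - 1#) s-1-bound)
    where
    P = λ r → ∃[ n ] r ≈ ι n
    s = ⨆ P
    isSup : IsSupremum P s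
    isSup = ⨆-isSupremum P (0# , 0 , refl)
      (x , λ r (n , r≈ιn) → ≤-trans (≤-reflexive r≈ιn) (ι≤x n))
    s-1<s : s - 1# < s
    s-1<s = begin-strict
      s - 1#        ≈⟨ +-identityˡ _ ⟨
      0# + (s - 1#) <⟨ +-monoˡ-< (s - 1#) 0<1 ⟩
      1# + (s - 1#) ≈⟨ +-comm 1# _ ⟩
      s - 1# + 1#   ≈⟨ x-y+y≈x s 1# ⟩
      s             ∎
    s-1-bound : UpperBound P (s - 1#)
    s-1-bound r (n , r≈ιn) = +-cancelʳ-≤ 1# (begin
      r + 1#      ≈⟨ +-congʳ r≈ιn ⟩
      ι n + 1#    ≈⟨ +-comm (ι n) 1# ⟩
      ι (suc n)   ≤⟨ proj₁ isSup _ (suc n , refl) ⟩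
      s           ≈⟨ x-y+y≈x s 1# ⟨
      s - 1# + 1# ∎)

  -- Classical use of the Archimedean property; inequalities are ¬¬-stable.
  with-ι-bound : ∀ z {x y} → (∀ n → z ≤ ι n → x ≤ y) → x ≤ y
  with-ι-bound z f = ≤-stable λ x≰y → archimedean z λ n →
    ≮⇒≥ λ z<ιn → x≰y (f n (inj₁ z<ιn))

  -- The passage to the limit: an error that stays constant while both sides grow with 2ᵏ is
  -- negligible. Otherwise y < x, and n ≤ 2ⁿ would bound every n by c / (x - y).
  ≤-from-scaled : ∀ c {x y} → (∀ k → ι 2 ^ k * x ≤ ι 2 ^ k * y + c) → x ≤ y
  ≤-from-scaled c {x} {y} scaled = ≮⇒≥ λ y<x → archimedean (c * (x - y) ⁻¹) λ n →
    let d = x - y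
        0<d = 0<y-x y<x
        2ⁿ = ι 2 ^ n
    in *-cancelˡ-≤ 0<d (begin
      d * ι n         ≤⟨ *-monoʳ-≤ (inj₁ 0<d) (ι≤2^ n) ⟩
      d * 2ⁿ          ≤⟨ +-cancelʳ-≤ (2ⁿ * y) (begin
        d * 2ⁿ + 2ⁿ * y   ≈⟨ solve 3 (λ a b c → a :* b :+ b :* c := b :* (a :+ c)) refl d 2ⁿ y ⟩
        2ⁿ * (d + y)      ≈⟨ *-congˡ (x-y+y≈x x y) ⟩
        2ⁿ * x            ≤⟨ scaled n ⟩
        2ⁿ * y + c        ≈⟨ +-comm _ c ⟩
        c + 2ⁿ * y        ∎) ⟩
      c               ≈⟨ *-identityʳ c ⟨
      c * 1#          ≈⟨ *-congˡ (x*x⁻¹≈1 0<d) ⟨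
      c * (d * d ⁻¹)  ≈⟨ solve 3 (λ a b c → a :* (b :* c) := b :* (a :* c)) refl c d (d ⁻¹) ⟩
      d * (c * d ⁻¹)  ∎)

-- The binary logarithm as a supremum of fractions

module LogProperties (ℝ : Reals) where

  open Reals ℝ
  open RealProperties ℝ
  open import Algebra.Solver.Ring.NaturalCoefficients.Default commutativeSemiring
    using (Polynomial; solve; con; _:=_; _:+_; _:*_)

  1≤⇒0< : ∀ {x} → 1# ≤ x → 0# < x
  1≤⇒0< {x} 1≤x = begin-strict
    0# <⟨ 0<1 ⟩
    1# ≤⟨ 1≤x ⟩
    x  ∎

  private
    -- ι 2, up to definitional equality.
    con2 : ∀ {n} → Polynomial n
    con2 = con 1 :+ (con 1 :+ con 0)

  -- The axiom for `⨆` requires some upper bound, and the crude log₂ x ≤ x will do: with s the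
  -- integer part of the fraction, 2ˢ ≤ x, so the fraction is at most s + 1 ≤ 2ˢ ≤ x.
  BelowLog₂⇒≤ : ∀ {x} → 1# ≤ x → UpperBound (BelowLog₂ x) x
  BelowLog₂⇒≤ {x} 1≤x q (a , b , c , qB≈a-c , 2ᵃ≤xᴮ2ᶜ) = *-cancelˡ-≤ (0<ι b) (begin
    ι B * q               ≈⟨ *-comm (ι B) q ⟩
    q * ι B               ≈⟨ qB≈a-c ⟩
    ι a - ι c             ≤⟨ +-monoˡ-≤ (- ι c) (ι-mono (ℕ.m≤n+m∸n a c)) ⟩
    ι (c ℕ.+ e) - ι c     ≈⟨ +-congʳ (trans (ι-+ c e) (+-comm (ι c) (ι e))) ⟩
    ι e + ι c - ι c       ≈⟨ x+y-y≈x (ι e) (ι c) ⟩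
    ι e                   ≤⟨ ι-mono e≤[1+s]B ⟩
    ι (suc s ℕ.* B)       ≈⟨ ι-* (suc s) B ⟩
    ι (suc s) * ι B       ≤⟨ *-monoˡ-≤ (0≤ι B) 1+s≤x ⟩
    x * ι B               ≈⟨ *-comm x (ι B) ⟩
    ι B * x               ∎)
    where
    B = suc b
    -- Truncated subtraction replaces a negative fraction by 0, which is still admissible because 1
    -- ≤ x.
    e = a ℕ.∸ c
    s = e ℕ./ B
    e≤[1+s]B : e ℕ.≤ suc s ℕ.* B
    e≤[1+s]B = ℕ.≤-trans (ℕ.≤-reflexive (ℕ.m≡m%n+[m/n]*n e B)) (ℕ.+-monoˡ-≤ _ (ℕ.m%n≤n e B))
    2ᵉ≤xᴮ : ι 2 ^ e ≤ x ^ B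
    2ᵉ≤xᴮ with ℕ.≤-total a c
    ... | inj₁ a≤c rewrite ℕ.m≤n⇒m∸n≡0 a≤c = 1≤x^n B 1≤x
    ... | inj₂ c≤a = *-cancelˡ-≤ (^-pos c (0<ι 1)) (begin
      ι 2 ^ c * ι 2 ^ e   ≈⟨ ^-homo-* (ι 2) c e ⟨
      ι 2 ^ (c ℕ.+ e)     ≡⟨ ≡.cong (ι 2 ^_) (ℕ.m+[n∸m]≡n c≤a) ⟩
      ι 2 ^ a             ≤⟨ 2ᵃ≤xᴮ2ᶜ ⟩
      x ^ B * ι 2 ^ c     ≈⟨ *-comm _ _ ⟩
      ι 2 ^ c * x ^ B     ∎)
    1+s≤x : ι (suc s) ≤ x
    1+s≤x = begin
      ι (suc s)   ≤⟨ ι-mono (n<2^n s) ⟩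
      ι (2 ℕ.^ s) ≈⟨ ι-^ 2 s ⟩
      ι 2 ^ s     ≤⟨ ^-cancelʳ-≤ b (1≤⇒0< 1≤x) (begin
        (ι 2 ^ s) ^ B     ≈⟨ ^-assocʳ (ι 2) s B ⟩
        ι 2 ^ (s ℕ.* B)   ≤⟨ ^-monoʳ-≤ 1≤2 (ℕ.m/n*n≤m e B) ⟩
        ι 2 ^ e           ≤⟨ 2ᵉ≤xᴮ ⟩
        x ^ B             ∎) ⟩
      x           ∎

  log₂-isSupremum : ∀ {x} → 1# ≤ x → IsSupremum (BelowLog₂ x) (log₂ x)
  log₂-isSupremum {x} 1≤x = ⨆-isSupremum _ (0# , 0 , 0 , 0 , zero-fraction , (begin
      1#         ≤⟨ 1≤x ⟩
      x          ≈⟨ *-identityʳ x ⟨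
      x ^ 1      ≈⟨ *-identityʳ _ ⟨
      x ^ 1 * 1# ∎))
    (x , BelowLog₂⇒≤ 1≤x)
    where
    zero-fraction : 0# * ι 1 ≈ ι 0 - ι 0
    zero-fraction = trans (zeroˡ _) (sym (-‿inverseʳ 0#))

  -- Every later lower bound on `log₂` goes through here: for n > 0 the fraction a / n belongs to
  -- the defining set, with c = 0. For n = 0 the hypothesis forces a = 0.
  2^a≤x^n⇒a≤n*log₂x : ∀ {x} a n → 1# ≤ x → ι 2 ^ a ≤ x ^ n → ι a ≤ ι n * log₂ x
  2^a≤x^n⇒a≤n*log₂x {x} a zero 1≤x 2ᵃ≤1 with z≤n ← 2^-cancel-≤ {a} {0} 2ᵃ≤1 =
    ≤-reflexive (sym (zeroˡ _))
  2^a≤x^n⇒a≤n*log₂x {x} a n@(suc b) 1≤x 2ᵃ≤xⁿ = begin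
    ι a                 ≈⟨ nq≈a ⟨
    ι n * q             ≤⟨ *-monoʳ-≤ (0≤ι n) (proj₁ (log₂-isSupremum 1≤x) q (a , b , 0 ,
                            trans (*-comm q (ι n)) (trans nq≈a (sym a-0≈a)) ,
                            ≤-trans 2ᵃ≤xⁿ (≤-reflexive (sym (*-identityʳ _))))) ⟩
    ι n * log₂ x        ∎
    where
    q = ι a * ι n ⁻¹
    nq≈a : ι n * q ≈ ι a
    nq≈a = begin-equality
      ι n * (ι a * ι n ⁻¹) ≈⟨ solve 3 (λ a b c → a :* (b :* c) := b :* (a :* c)) refl (ι n) (ι a) (ι n ⁻¹) ⟩
      ι a * (ι n * ι n ⁻¹) ≈⟨ *-congˡ (x*x⁻¹≈1 (0<ι b)) ⟩
      ι a * 1#             ≈⟨ *-identityʳ _ ⟩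
      ι a                  ∎
    a-0≈a : ι a - ι 0 ≈ ι a
    a-0≈a = trans (sym (+-identityʳ _)) (x-y+y≈x (ι a) 0#)

  0≤log₂ : ∀ {x} → 1# ≤ x → 0# ≤ log₂ x
  0≤log₂ {x} 1≤x = begin
    0#            ≤⟨ 2^a≤x^n⇒a≤n*log₂x 0 1 1≤x (1≤x^n 1 1≤x) ⟩
    ι 1 * log₂ x  ≈⟨ *-congʳ (+-identityʳ 1#) ⟩
    1# * log₂ x   ≈⟨ *-identityˡ _ ⟩
    log₂ x        ∎

  -- The a priori bound 2ⁿ makes this a finite downward search.
  floor-log₂ : ∀ {z} n → 1# ≤ z → z < ι 2 ^ n → ∃[ u ] ι 2 ^ u ≤ z × z ≤ ι 2 ^ suc u
  floor-log₂ zero    1≤z z<1 = ⊥-elim (<⇒≱ z<1 1≤z)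
  floor-log₂ {z} (suc n) 1≤z z<2ⁿ⁺¹ with ι 2 ^ n ≤? z
  ... | yes 2ⁿ≤z = n , 2ⁿ≤z , inj₁ z<2ⁿ⁺¹
  ... | no  2ⁿ≰z = floor-log₂ n 1≤z (≰⇒> 2ⁿ≰z)

  -- In continuation form, because a bound to start the search from exists only classically: the
  -- exponent may be used while proving an inequality, but is not returned.
  with-floor-log₂ : ∀ {z x y} → 1# ≤ z →
                    (∀ u → ι 2 ^ u ≤ z → z ≤ ι 2 ^ suc u → x ≤ y) → x ≤ y
  with-floor-log₂ {z} 1≤z f = with-ι-bound z λ n z≤n →
    let u , lower , upper = floor-log₂ (suc n) 1≤z (begin-strict
          z            ≤⟨ z≤n ⟩
          ι n          ≈⟨ +-identityˡ (ι n) ⟨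
          0# + ι n     <⟨ +-monoˡ-< (ι n) 0<1 ⟩
          ι (suc n)    ≤⟨ ι≤2^ (suc n) ⟩
          ι 2 ^ suc n  ∎)
    in f u lower upper

  log₂-≤-+ : ∀ {x y z} → 1# ≤ x → 1# ≤ y → 1# ≤ z → z ≤ x * y → log₂ z ≤ log₂ x + log₂ y
  log₂-≤-+ {x} {y} {z} 1≤x 1≤y 1≤z z≤xy = proj₂ (log₂-isSupremum 1≤z) _ below
    where
    below : UpperBound (BelowLog₂ z) (log₂ x + log₂ y)
    below q (a , b , c , qB≈a-c , 2ᵃ≤zᴮ2ᶜ) =
      *-cancelˡ-≤ (0<ι b) (≤-from-scaled (ι 2) λ k →
      let K = 2 ℕ.^ k
          n = B ℕ.* K
      in with-floor-log₂ (1≤x^n n 1≤x) λ u 2ᵘ≤xⁿ xⁿ≤2ᵘ⁺¹ →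
         with-floor-log₂ (1≤x^n n 1≤y) λ v 2ᵛ≤yⁿ yⁿ≤2ᵛ⁺¹ →
      let r = suc u ℕ.+ suc v
          aK≤ : a ℕ.* K ℕ.≤ r ℕ.+ c ℕ.* K
          aK≤ = 2^-cancel-≤ (begin
            ι 2 ^ (a ℕ.* K)               ≈⟨ ^-assocʳ (ι 2) a K ⟨
            (ι 2 ^ a) ^ K                 ≤⟨ ^-monoˡ-≤ K (^-nonNeg a 0≤2) 2ᵃ≤zᴮ2ᶜ ⟩
            (z ^ B * ι 2 ^ c) ^ K         ≈⟨ ^-distrib-* _ _ K ⟩
            (z ^ B) ^ K * (ι 2 ^ c) ^ K   ≈⟨ *-cong (^-assocʳ z B K) (^-assocʳ (ι 2) c K) ⟩
            z ^ n * ι 2 ^ (c ℕ.* K)       ≤⟨ *-monoˡ-≤ (^-nonNeg (c ℕ.* K) 0≤2) (begin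
              z ^ n                       ≤⟨ ^-monoˡ-≤ n (≤-trans 0≤1 1≤z) z≤xy ⟩
              (x * y) ^ n                 ≈⟨ ^-distrib-* x y n ⟩
              x ^ n * y ^ n               ≤⟨ *-mono-≤ (^-nonNeg (suc u) 0≤2)
                                               (^-nonNeg n (≤-trans 0≤1 1≤y)) xⁿ≤2ᵘ⁺¹ yⁿ≤2ᵛ⁺¹ ⟩
              ι 2 ^ suc u * ι 2 ^ suc v   ≈⟨ ^-homo-* (ι 2) (suc u) (suc v) ⟨
              ι 2 ^ r                     ∎) ⟩
            ι 2 ^ r * ι 2 ^ (c ℕ.* K)     ≈⟨ ^-homo-* (ι 2) r (c ℕ.* K) ⟨
            ι 2 ^ (r ℕ.+ c ℕ.* K)         ∎)
          K' = ι 2 ^ k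
          ι-*K : ∀ m → ι (m ℕ.* K) ≈ ι m * K'
          ι-*K m = trans (ι-* m K) (*-congˡ (ι-^ 2 k))
      -- Adding `K' * ι c` to both sides clears the difference in the numerator of `q`.
      in +-cancelʳ-≤ (K' * ι c) (begin
        K' * (ι B * q) + K' * ι c
          ≈⟨ solve 4 (λ k b q c → k :* (b :* q) :+ k :* c := k :* (q :* b :+ c)) refl K' (ι B) q (ι c) ⟩
        K' * (q * ι B + ι c)           ≈⟨ *-congˡ (trans (+-congʳ qB≈a-c) (x-y+y≈x (ι a) (ι c))) ⟩
        K' * ι a                       ≈⟨ *-comm K' (ι a) ⟩
        ι a * K'                       ≈⟨ ι-*K a ⟨
        ι (a ℕ.* K)                    ≤⟨ ι-mono aK≤ ⟩
        ι (r ℕ.+ c ℕ.* K)              ≈⟨ ι-+ r (c ℕ.* K) ⟩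
        ι r + ι (c ℕ.* K)              ≈⟨ +-cong (ι-+ (suc u) (suc v)) (ι-*K c) ⟩
        (1# + ι u + (1# + ι v)) + ι c * K'
          ≤⟨ +-monoˡ-≤ (ι c * K') (+-mono-≤ (+-monoʳ-≤ 1# (2^a≤x^n⇒a≤n*log₂x u n 1≤x 2ᵘ≤xⁿ))
                                            (+-monoʳ-≤ 1# (2^a≤x^n⇒a≤n*log₂x v n 1≤y 2ᵛ≤yⁿ))) ⟩
        (1# + ι n * log₂ x + (1# + ι n * log₂ y)) + ι c * K'
          ≈⟨ +-congʳ (+-cong (+-congˡ (*-congʳ (ι-*K B))) (+-congˡ (*-congʳ (ι-*K B)))) ⟩
        (1# + ι B * K' * log₂ x + (1# + ι B * K' * log₂ y)) + ι c * K'
          ≈⟨ solve 5 (λ b k x y c → (con 1 :+ b :* k :* x :+ (con 1 :+ b :* k :* y)) :+ c :* k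
               := k :* (b :* (x :+ y)) :+ con2 :+ k :* c) refl (ι B) K' (log₂ x) (log₂ y) (ι c) ⟩
        K' * (ι B * (log₂ x + log₂ y)) + ι 2 + K' * ι c ∎))
      where
      B = suc b

  -- The logarithm above its chords

  2*xy≤x²+y²-ordered : ∀ {x y} → x ≤ y → ι 2 * (x * y) ≤ x * x + y * y
  2*xy≤x²+y²-ordered {x} {y} x≤y = begin
    -- In terms of e = y - x the two sides differ by e * e, and no subtraction is left.
    ι 2 * (x * y)               ≈⟨ *-congˡ (*-congˡ y≈e+x) ⟩
    ι 2 * (x * (e + x))         ≤⟨ x≤x+y (*-nonNeg 0≤e 0≤e) ⟩
    ι 2 * (x * (e + x)) + e * e ≈⟨ solve 2 (λ x e → con2 :* (x :* (e :+ x)) :+ e :* e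
                                     := x :* x :+ (e :+ x) :* (e :+ x)) refl x e ⟩
    x * x + (e + x) * (e + x)   ≈⟨ +-congˡ (*-cong y≈e+x y≈e+x) ⟨
    x * x + y * y               ∎
    where
    e = y - x
    y≈e+x = sym (x-y+y≈x y x)
    0≤e : 0# ≤ e
    0≤e = ≤-trans (≤-reflexive (sym (-‿inverseʳ x))) (+-monoˡ-≤ (- x) x≤y)

  -- Taken at (y, 1) this says that squaring at least doubles y - 1; taken at (y, 2) it serves the
  -- squares that exceed 2.
  2*xy≤x²+y² : ∀ x y → ι 2 * (x * y) ≤ x * x + y * y
  2*xy≤x²+y² x y with x ≤? y
  ... | yes x≤y = 2*xy≤x²+y²-ordered x≤y
  ... | no  x≰y = begin
    ι 2 * (x * y) ≈⟨ *-congˡ (*-comm x y) ⟩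
    ι 2 * (y * x) ≤⟨ 2*xy≤x²+y²-ordered (inj₁ (≰⇒> x≰y)) ⟩
    y * y + x * x ≈⟨ +-comm _ _ ⟩
    x * x + y * y ∎

  square-^ : ∀ x n → (x * x) ^ n ≈ x ^ (2 ℕ.* n)
  square-^ x n = trans (^-congˡ n (*-congˡ (sym (*-identityʳ x)))) (^-assocʳ x 2 n)

  half : Carrier
  half = ι 2 ⁻¹

  2*half : ∀ x → ι 2 * (half * x) ≈ x
  2*half x = trans (sym (*-assoc _ _ x)) (trans (*-congʳ (x*x⁻¹≈1 (0<ι 1))) (*-identityˡ x))

  -- The chord of log₂ between 1 and 2 at scale 2 ^ k. Squaring y doubles
  -- its logarithm and at least doubles the height y - 1 of the chord, also
  -- after halving a square that exceeds 2.
  chord-scaled : ∀ k {y} → 1# ≤ y → y ≤ ι 2 →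
                 ∃[ u ] ι 2 ^ u ≤ y ^ (2 ℕ.^ k) × ι 2 ^ k * y ≤ ι (suc u) + ι 2 ^ k
  chord-scaled zero {y} 1≤y y≤2 = 0 , 1≤x^n 1 1≤y , (begin
    1# * y    ≈⟨ *-identityˡ y ⟩
    y         ≤⟨ y≤2 ⟩
    ι 2       ≈⟨ +-comm 1# (ι 1) ⟩
    ι 1 + 1#  ∎)
  chord-scaled (suc k) {y} 1≤y y≤2 with y * y ≤? ι 2
  ... | yes y²≤2 =
    let u , 2ᵘ≤ , chord = chord-scaled k 1≤y² y²≤2
    in u , ≤-trans 2ᵘ≤ (≤-reflexive (square-^ y (2 ℕ.^ k))) , (begin
      ι 2 * K' * y
        ≈⟨ solve 3 (λ t k y → t :* k :* y := k :* (t :* (y :* con 1))) refl (ι 2) K' y ⟩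
      K' * (ι 2 * (y * 1#))    ≤⟨ *-monoʳ-≤ 0≤K' (2*xy≤x²+y² y 1#) ⟩
      K' * (y * y + 1# * 1#)
        ≈⟨ solve 2 (λ k z → k :* (z :+ con 1 :* con 1) := k :* z :+ k) refl K' (y * y) ⟩
      K' * (y * y) + K'        ≤⟨ +-monoˡ-≤ K' chord ⟩
      ι (suc u) + K' + K'      ≈⟨ solve 2 (λ u k → u :+ k :+ k := u :+ con2 :* k) refl (ι (suc u)) K' ⟩
      ι (suc u) + ι 2 * K'     ∎)
    where
    K' = ι 2 ^ k
    0≤K' = ^-nonNeg k 0≤2
    1≤y² : 1# ≤ y * y
    1≤y² = ≤-trans (1≤x^n 2 1≤y) (≤-reflexive (*-congˡ (*-identityʳ y)))
  ... | no  y²≰2 =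
    let u , 2ᵘ≤ , chord = chord-scaled k 1≤z z≤2
    -- The factor 2 in y * y = 2 z contributes 2 ^ K to the K-th power, hence K to the exponent.
    in u ℕ.+ K , (begin
      ι 2 ^ (u ℕ.+ K)       ≈⟨ ^-homo-* (ι 2) u K ⟩
      ι 2 ^ u * ι 2 ^ K     ≤⟨ *-monoˡ-≤ (^-nonNeg K 0≤2) 2ᵘ≤ ⟩
      z ^ K * ι 2 ^ K       ≈⟨ *-comm _ _ ⟩
      ι 2 ^ K * z ^ K       ≈⟨ ^-distrib-* (ι 2) z K ⟨
      (ι 2 * z) ^ K         ≈⟨ ^-congˡ K 2z≈y² ⟩
      (y * y) ^ K           ≈⟨ square-^ y K ⟩
      y ^ (2 ℕ.* K)         ∎) , (begin
      ι 2 * K' * y                     ≈⟨ solve 3 (λ t k y → t :* k :* y := k :* (t :* y)) refl (ι 2) K' y ⟩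
      K' * (ι 2 * y)                   ≤⟨ *-monoʳ-≤ 0≤K' 2y≤z+2 ⟩
      K' * (z + ι 2)                   ≈⟨ distribˡ K' z (ι 2) ⟩
      K' * z + K' * ι 2                ≤⟨ +-monoˡ-≤ (K' * ι 2) chord ⟩
      ι (suc u) + K' + K' * ι 2
        ≈⟨ +-cong (sym (trans (ι-+ (suc u) K) (+-congˡ (ι-^ 2 k)))) (*-comm K' (ι 2)) ⟩
      ι (suc (u ℕ.+ K)) + ι 2 * K'     ∎)
    where
    K = 2 ℕ.^ k
    K' = ι 2 ^ k
    0≤K' = ^-nonNeg k 0≤2
    z = half * (y * y)
    2z≈y² = 2*half (y * y)
    1≤z : 1# ≤ z
    1≤z = *-cancelˡ-≤ (0<ι 1) (begin
      ι 2 * 1#   ≈⟨ *-identityʳ _ ⟩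
      ι 2        ≤⟨ inj₁ (≰⇒> y²≰2) ⟩
      y * y      ≈⟨ 2z≈y² ⟨
      ι 2 * z    ∎)
    z≤2 : z ≤ ι 2
    z≤2 = *-cancelˡ-≤ (0<ι 1) (begin
      ι 2 * z      ≈⟨ 2z≈y² ⟩
      y * y        ≤⟨ *-mono-≤ 0≤2 (≤-trans 0≤1 1≤y) y≤2 y≤2 ⟩
      ι 2 * ι 2    ∎)
    2y≤z+2 : ι 2 * y ≤ z + ι 2
    2y≤z+2 = *-cancelˡ-≤ (0<ι 1) (begin
      ι 2 * (ι 2 * y)       ≈⟨ *-congˡ (*-comm (ι 2) y) ⟩
      ι 2 * (y * ι 2)       ≤⟨ 2*xy≤x²+y² y (ι 2) ⟩
      y * y + ι 2 * ι 2     ≈⟨ +-congʳ 2z≈y² ⟨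
      ι 2 * z + ι 2 * ι 2   ≈⟨ distribˡ (ι 2) z (ι 2) ⟨
      ι 2 * (z + ι 2)       ∎)

  -- Here i + (y - 1) is the height at 2ⁱ y of the chord of log₂ over the interval from 2ⁱ to 2ⁱ⁺¹.
  -- The unit lost in `chord-scaled` at every scale vanishes in the limit.
  log₂-chord : ∀ {x y} i → 1# ≤ y → y ≤ ι 2 → ι 2 ^ i * y ≤ x → ι i + y ≤ log₂ x + 1#
  log₂-chord {x} {y} i 1≤y y≤2 2ⁱy≤x = ≤-from-scaled 1# λ k →
    let K = 2 ℕ.^ k
        K' = ι 2 ^ k
        u , 2ᵘ≤yᴷ , chord = chord-scaled k 1≤y y≤2
    in begin
      K' * (ι i + y)             ≈⟨ distribˡ K' (ι i) y ⟩
      K' * ι i + K' * y          ≤⟨ +-monoʳ-≤ (K' * ι i) chord ⟩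
      K' * ι i + (1# + ι u + K')
        ≈⟨ solve 3 (λ k i u → k :* i :+ (con 1 :+ u :+ k) := i :* k :+ u :+ k :+ con 1) refl K' (ι i) (ι u) ⟩
      ι i * K' + ι u + K' + 1#   ≈⟨ +-congʳ (+-congʳ (+-congʳ (trans (ι-* i K) (*-congˡ (ι-^ 2 k))))) ⟨
      ι (i ℕ.* K) + ι u + K' + 1# ≈⟨ +-congʳ (+-congʳ (ι-+ (i ℕ.* K) u)) ⟨
      ι (i ℕ.* K ℕ.+ u) + K' + 1#
        ≤⟨ +-monoˡ-≤ 1# (+-monoˡ-≤ K' (2^a≤x^n⇒a≤n*log₂x (i ℕ.* K ℕ.+ u) K 1≤x (begin
        ι 2 ^ (i ℕ.* K ℕ.+ u)      ≈⟨ ^-homo-* (ι 2) (i ℕ.* K) u ⟩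
        ι 2 ^ (i ℕ.* K) * ι 2 ^ u  ≤⟨ *-monoʳ-≤ (^-nonNeg (i ℕ.* K) 0≤2) 2ᵘ≤yᴷ ⟩
        ι 2 ^ (i ℕ.* K) * y ^ K    ≈⟨ *-congʳ (^-assocʳ (ι 2) i K) ⟨
        (ι 2 ^ i) ^ K * y ^ K      ≈⟨ ^-distrib-* (ι 2 ^ i) y K ⟨
        (ι 2 ^ i * y) ^ K          ≤⟨ ^-monoˡ-≤ K (*-nonNeg (^-nonNeg i 0≤2) (≤-trans 0≤1 1≤y)) 2ⁱy≤x ⟩
        x ^ K                      ∎))) ⟩
      ι K * log₂ x + K' + 1#     ≈⟨ +-congʳ (+-congʳ (*-congʳ (ι-^ 2 k))) ⟩
      K' * log₂ x + K' + 1#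
        ≈⟨ solve 2 (λ k l → k :* l :+ k :+ con 1 := k :* (l :+ con 1) :+ con 1) refl K' (log₂ x) ⟩
      K' * (log₂ x + 1#) + 1#    ∎
    where
    1≤x : 1# ≤ x
    1≤x = begin
      1#            ≈⟨ *-identityʳ 1# ⟨
      1# * 1#       ≤⟨ *-mono-≤ (^-nonNeg i 0≤2) 0≤1 (1≤x^n i 1≤2) 1≤y ⟩
      ι 2 ^ i * y   ≤⟨ 2ⁱy≤x ⟩
      x             ∎

  -- The exponent of 2 in x is at least 1 and at most n - 1. Both facts sit in the two successors of
  -- the equation for n, which can be matched against `refl`.
  dyadic-decomposition : ∀ {x} n → ι 2 ≤ x → x < ι 2 ^ n →
    ∃[ i ] ∃[ d ] ∃[ y ] n ≡ suc i ℕ.+ suc d × x ≈ ι 2 ^ suc i * y × 1# ≤ y × y ≤ ι 2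
  dyadic-decomposition zero 2≤x x<1 = ⊥-elim (<⇒≱ x<1 (≤-trans 1≤2 2≤x))
  dyadic-decomposition {x} (suc n) 2≤x x<2ⁿ⁺¹ with ι 2 ^ n ≤? x
  ... | no 2ⁿ≰x =
    let i , d , y , n≡ , rest = dyadic-decomposition n 2≤x (≰⇒> 2ⁿ≰x)
    in i , suc d , y , ≡.trans (≡.cong suc n≡) (≡.sym (ℕ.+-suc (suc i) (suc d))) , rest
  dyadic-decomposition (suc zero) 2≤x x<2 | yes _ =
    ⊥-elim (<⇒≱ x<2 (≤-trans (≤-reflexive (*-identityʳ (ι 2))) 2≤x))
  dyadic-decomposition {x} (suc n@(suc i)) 2≤x x<2ⁿ⁺¹ | yes 2ⁿ≤x = i , 0 , y , ℕ.+-comm 1 n , x≈2ⁿy ,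
    *-cancelˡ-≤ 0<2ⁿ (begin
      ι 2 ^ n * 1#   ≈⟨ *-identityʳ _ ⟩
      ι 2 ^ n        ≤⟨ 2ⁿ≤x ⟩
      x              ≈⟨ x≈2ⁿy ⟩
      ι 2 ^ n * y    ∎) ,
    *-cancelˡ-≤ 0<2ⁿ (begin
      ι 2 ^ n * y    ≈⟨ x≈2ⁿy ⟨
      x              ≤⟨ inj₁ x<2ⁿ⁺¹ ⟩
      ι 2 * ι 2 ^ n  ≈⟨ *-comm _ _ ⟩
      ι 2 ^ n * ι 2  ∎)
    where
    0<2ⁿ = ^-pos n (0<ι 1)
    y = (ι 2 ^ n) ⁻¹ * x
    x≈2ⁿy : x ≈ ι 2 ^ n * y
    x≈2ⁿy = sym (trans (sym (*-assoc _ _ x)) (trans (*-congʳ (x*x⁻¹≈1 0<2ⁿ)) (*-identityˡ x)))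

  -- For x < 2 ^ n this says that log₂ x / x is at least its value at 2 ^ n.
  n⊓n*x/2^n≤log₂x : ∀ {x} n → ι 2 ≤ x → ι n ≤ log₂ x ⊎ ι n * x ≤ ι 2 ^ n * log₂ x
  n⊓n*x/2^n≤log₂x {x} n 2≤x with ι 2 ^ n ≤? x
  ... | yes 2ⁿ≤x = inj₁ (begin
    ι n
      ≤⟨ 2^a≤x^n⇒a≤n*log₂x n 1 (≤-trans 1≤2 2≤x) (≤-trans 2ⁿ≤x (≤-reflexive (sym (*-identityʳ x)))) ⟩
    ι 1 * log₂ x    ≈⟨ *-congʳ (+-identityʳ 1#) ⟩
    1# * log₂ x     ≈⟨ *-identityˡ _ ⟩
    log₂ x          ∎)
  ... | no  2ⁿ≰x with dyadic-decomposition n 2≤x (≰⇒> 2ⁿ≰x)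
  ... | i , d , y , ≡.refl , x≈2ⁱ⁺¹y , 1≤y , y≤2 = inj₂ (begin
    ι n * x                               ≈⟨ *-cong (ι-+ (suc i) (suc d)) x≈2ⁱ⁺¹y ⟩
    (ι (suc i) + ι (suc d)) * (P * y)
      -- One unit moves from `suc i` to the other summand. Then y ≤ D and d + 2 ≤ D leave D * (i +
      -- y), where i + y is the chord height at x.
      ≈⟨ solve 4 (λ i d p y → (con 1 :+ i :+ d) :* (p :* y)
          := p :* (i :* y :+ (con 1 :+ d) :* y)) refl (ι i) (ι (suc d)) P y ⟩
    P * (ι i * y + ι (suc (suc d)) * y)
      ≤⟨ *-monoʳ-≤ 0≤P (+-mono-≤ (*-monoʳ-≤ (0≤ι i) y≤D) (*-monoˡ-≤ (≤-trans 0≤1 1≤y) 2+d≤D)) ⟩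
    P * (ι i * D + D * y)
      ≈⟨ solve 4 (λ p i d y → p :* (i :* d :+ d :* y) := p :* d :* (i :+ y)) refl P (ι i) D y ⟩
    P * D * (ι i + y)
      ≤⟨ *-monoʳ-≤ (*-nonNeg 0≤P (^-nonNeg (suc d) 0≤2)) (+-cancelʳ-≤ 1# (begin
      ι i + y + 1#      ≈⟨ solve 2 (λ i y → i :+ y :+ con 1 := con 1 :+ i :+ y) refl (ι i) y ⟩
      ι (suc i) + y     ≤⟨ log₂-chord (suc i) 1≤y y≤2 (≤-reflexive (sym x≈2ⁱ⁺¹y)) ⟩
      log₂ x + 1#       ∎)) ⟩
    P * D * log₂ x                        ≈⟨ *-congʳ (^-homo-* (ι 2) (suc i) (suc d)) ⟨
    ι 2 ^ n * log₂ x                      ∎)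
    where
    P = ι 2 ^ suc i
    D = ι 2 ^ suc d
    0≤P = ^-nonNeg (suc i) 0≤2
    2+d≤D : ι (suc (suc d)) ≤ D
    2+d≤D = ≤-trans (ι-mono (n<2^n (suc d))) (≤-reflexive (ι-^ 2 (suc d)))
    y≤D : y ≤ D
    y≤D = ≤-trans y≤2 (≤-trans (ι-mono {2} {suc (suc d)} (s≤s (s≤s z≤n))) 2+d≤D)

-- Finite sums over lists and counting

module ListSums (ℝ : Reals) where

  open Reals ℝ
  open RealProperties ℝ
  open import Algebra.Properties.CommutativeSemigroup +-commutativeSemigroup using (interchange)

  private variable A B C : Set

  -- Has the shape of the body of `𝔼`, so that an expectation is definitionally a weighted `∑` over
  -- `allTries`.
  ∑ : List A → (A → Carrier) → Carrier
  ∑ xs f = foldr _+_ 0# (map f xs)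

  ∑-cong : ∀ (xs : List A) {f g} → (∀ x → f x ≈ g x) → ∑ xs f ≈ ∑ xs g
  ∑-cong []       f≈g = refl
  ∑-cong (x ∷ xs) f≈g = +-cong (f≈g x) (∑-cong xs f≈g)

  ∑-mono : ∀ (xs : List A) {f g} → (∀ x → f x ≤ g x) → ∑ xs f ≤ ∑ xs g
  ∑-mono []       f≤g = ≤-refl
  ∑-mono (x ∷ xs) f≤g = +-mono-≤ (f≤g x) (∑-mono xs f≤g)

  ∑-0 : ∀ (xs : List A) → ∑ xs (λ _ → 0#) ≈ 0#
  ∑-0 []       = refl
  ∑-0 (x ∷ xs) = trans (+-identityˡ _) (∑-0 xs)

  ∑-1 : ∀ (xs : List A) → ∑ xs (λ _ → 1#) ≈ ι (length xs)
  ∑-1 []       = refl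
  ∑-1 (x ∷ xs) = +-congˡ (∑-1 xs)

  ∑-nonNeg : ∀ (xs : List A) {f} → (∀ x → 0# ≤ f x) → 0# ≤ ∑ xs f
  ∑-nonNeg xs 0≤f = ≤-trans (≤-reflexive (sym (∑-0 xs))) (∑-mono xs 0≤f)

  ∑-distribˡ : ∀ (xs : List A) c f → c * ∑ xs f ≈ ∑ xs (λ x → c * f x)
  ∑-distribˡ []       c f = zeroʳ c
  ∑-distribˡ (x ∷ xs) c f = trans (distribˡ c _ _) (+-congˡ (∑-distribˡ xs c f))

  ∑-+ : ∀ (xs : List A) f g → ∑ xs (λ x → f x + g x) ≈ ∑ xs f + ∑ xs g
  ∑-+ []       f g = sym (+-identityˡ 0#)
  ∑-+ (x ∷ xs) f g = trans (+-congˡ (∑-+ xs f g)) (interchange _ _ _ _)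

  ∑-++ : ∀ (xs ys : List A) f → ∑ (xs ++ ys) f ≈ ∑ xs f + ∑ ys f
  ∑-++ []       ys f = sym (+-identityˡ _)
  ∑-++ (x ∷ xs) ys f = trans (+-congˡ (∑-++ xs ys f)) (sym (+-assoc _ _ _))

  ∑-map : ∀ (g : A → B) xs f → ∑ (map g xs) f ≈ ∑ xs (f ∘ g)
  ∑-map g []       f = refl
  ∑-map g (x ∷ xs) f = +-congˡ (∑-map g xs f)

  ∑-swap : ∀ (xs : List A) (ys : List B) (f : A → B → Carrier) →
           ∑ xs (λ x → ∑ ys (f x)) ≈ ∑ ys (λ y → ∑ xs (λ x → f x y))
  ∑-swap []       ys f = sym (∑-0 ys)
  ∑-swap (x ∷ xs) ys f = trans (+-congˡ (∑-swap xs ys f)) (sym (∑-+ ys (f x) (λ y → ∑ xs (λ x → f x y))))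

  ∑-cartesianProductWith : ∀ (g : A → B → C) xs ys f →
    ∑ (cartesianProductWith g xs ys) f ≈ ∑ xs (λ x → ∑ ys (λ y → f (g x y)))
  ∑-cartesianProductWith g []       ys f = refl
  ∑-cartesianProductWith g (x ∷ xs) ys f =
    trans (∑-++ (map (g x) ys) _ f) (+-cong (∑-map (g x) ys f) (∑-cartesianProductWith g xs ys f))

  ∑-tabulate : ∀ {n} (g : Fin n → A) f → ∑ (tabulate g) f ≈ sum (f ∘ g)
  ∑-tabulate {n = zero}  g f = refl
  ∑-tabulate {n = suc n} g f = +-congˡ (∑-tabulate (g ∘ Fin.suc) f)

  ∑-allFin : ∀ {n} (f : Fin n → Carrier) → ∑ (allFin n) f ≈ sum f
  ∑-allFin = ∑-tabulate id

  ∑-filter-≤ : ∀ {P : Pred A 0ℓ} (P? : Decidable P) xs {f} → (∀ x → 0# ≤ f x) →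
               ∑ (filter P? xs) f ≤ ∑ xs f
  ∑-filter-≤ P? []       0≤f = ≤-refl
  ∑-filter-≤ P? (x ∷ xs) {f} 0≤f with does (P? x)
  ... | true  = +-monoʳ-≤ (f x) (∑-filter-≤ P? xs 0≤f)
  ... | false = begin
    ∑ (filter P? xs) f  ≤⟨ ∑-filter-≤ P? xs 0≤f ⟩
    ∑ xs f              ≤⟨ x≤x+y (0≤f x) ⟩
    ∑ xs f + f x        ≈⟨ +-comm _ _ ⟩
    f x + ∑ xs f        ∎

  -- With an indicator for f this becomes the union bound: occurring at all counts at most as much
  -- as occurring with multiplicity.
  ∑-deduplicate-≤ : ∀ (_≟_ : DecidableEquality A) xs {f} → (∀ x → 0# ≤ f x) →
                    ∑ (deduplicate _≟_ xs) f ≤ ∑ xs f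
  ∑-deduplicate-≤ _≟_ []       0≤f = ≤-refl
  ∑-deduplicate-≤ _≟_ (x ∷ xs) {f} 0≤f = +-monoʳ-≤ (f x)
    (≤-trans (∑-filter-≤ _ (deduplicate _≟_ xs) 0≤f) (∑-deduplicate-≤ _≟_ xs 0≤f))

  ∈⇒≤∑ : ∀ {x} {xs : List A} {f} → (∀ x → 0# ≤ f x) → x ∈ xs → f x ≤ ∑ xs f
  ∈⇒≤∑ {xs = _ ∷ xs} 0≤f (here ≡.refl) = x≤x+y (∑-nonNeg xs 0≤f)
  ∈⇒≤∑ {x = x} {y ∷ xs} {f} 0≤f (there x∈xs) = begin
    f x            ≤⟨ ∈⇒≤∑ 0≤f x∈xs ⟩
    ∑ xs f         ≤⟨ x≤x+y (0≤f y) ⟩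
    ∑ xs f + f y   ≈⟨ +-comm _ _ ⟩
    f y + ∑ xs f   ∎

  ι-sum : ∀ (xs : List A) (f : A → ℕ) → ι (foldr ℕ._+_ 0 (map f xs)) ≈ ∑ xs (ι ∘ f)
  ι-sum []       f = refl
  ι-sum (x ∷ xs) f = trans (ι-+ (f x) _) (+-congˡ (ι-sum xs f))

  sum-≤-const : ∀ {n} {f : Fin n → Carrier} c → (∀ i → f i ≤ c) → sum f ≤ ι n * c
  sum-≤-const {zero}  c f≤c = ≤-reflexive (sym (zeroˡ c))
  sum-≤-const {suc n} {f} c f≤c = begin
    f Fin.zero + sum (f ∘ Fin.suc) ≤⟨ +-mono-≤ (f≤c Fin.zero) (sum-≤-const c (f≤c ∘ Fin.suc)) ⟩
    c + ι n * c                    ≈⟨ +-congʳ (*-identityˡ c) ⟨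
    1# * c + ι n * c               ≈⟨ distribʳ c 1# (ι n) ⟨
    ι (suc n) * c                  ∎

  module Counting (_≟_ : DecidableEquality A) where

    𝟙[_≡_] : A → A → Carrier
    𝟙[ x ≡ y ] with x ≟ y
    ... | yes _ = 1#
    ... | no  _ = 0#

    𝟙-nonNeg : ∀ x y → 0# ≤ 𝟙[ x ≡ y ]
    𝟙-nonNeg x y with x ≟ y
    ... | yes _ = 0≤1
    ... | no  _ = ≤-refl

    𝟙-refl : ∀ x → 𝟙[ x ≡ x ] ≈ 1#
    𝟙-refl x with x ≟ x
    ... | yes _   = refl
    ... | no  x≢x = ⊥-elim (x≢x ≡.refl)

    *-𝟙-subst : ∀ (f : A → Carrier) x y → f y * 𝟙[ x ≡ y ] ≈ f x * 𝟙[ x ≡ y ]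
    *-𝟙-subst f x y with x ≟ y
    ... | yes ≡.refl = refl
    ... | no  _      = trans (zeroʳ _) (sym (zeroʳ _))

    count : A → List A → Carrier
    count x ys = ∑ ys 𝟙[ x ≡_]

    count-∉ : ∀ {x ys} → All (¬_ ∘ (x ≡_)) ys → count x ys ≈ 0#
    count-∉ [] = refl
    count-∉ {x} {y ∷ ys} (x≢y ∷ x∉ys) with x ≟ y
    ... | yes x≡y = ⊥-elim (x≢y x≡y)
    ... | no  _   = trans (+-identityˡ _) (count-∉ x∉ys)

    count-unique : ∀ x {ys} → Unique ys → count x ys ≤ 1#
    count-unique x [] = 0≤1
    count-unique x {y ∷ ys} (y∉ys ∷ ys!) with x ≟ y
    ... | yes ≡.refl = ≤-reflexive (trans (+-congˡ (count-∉ y∉ys)) (+-identityʳ 1#))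
    ... | no  _      = ≤-trans (≤-reflexive (+-identityˡ _)) (count-unique x ys!)

    -- Double counting: each entry of ys is met by at least one x. It splits the number of nodes of
    -- a level into one indicator per possible labelling.
    length≤∑-count : ∀ {xs} → (∀ x → x ∈ xs) → ∀ ys → ι (length ys) ≤ ∑ xs (λ x → count x ys)
    length≤∑-count {xs} complete ys = begin
      ι (length ys)                       ≈⟨ ∑-1 ys ⟨
      ∑ ys (λ _ → 1#)                     ≤⟨ ∑-mono ys (λ y → ≤-trans (≤-reflexive (sym (𝟙-refl y)))
                                              (∈⇒≤∑ {f = 𝟙[_≡ y ]} (λ x → 𝟙-nonNeg x y) (complete y))) ⟩
      ∑ ys (λ y → ∑ xs (λ x → 𝟙[ x ≡ y ])) ≈⟨ ∑-swap ys xs (λ y x → 𝟙[ x ≡ y ]) ⟩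
      ∑ xs (λ x → count x ys)             ∎

length-cartesianProductWith : ∀ {A B C : Set} (f : A → B → C) xs ys →
  length (cartesianProductWith f xs ys) ≡ length xs ℕ.* length ys
length-cartesianProductWith f []       ys = ≡.refl
length-cartesianProductWith f (x ∷ xs) ys = ≡.trans (List.length-++ (map (f x) ys))
  (≡.cong₂ ℕ._+_ (List.length-map (f x) ys) (length-cartesianProductWith f xs ys))

-- Subtrie lists of a single trie

module _ {A : Set} where

  subtries-< : ∀ {h j} (t : Trie A h) → h ℕ.< j → subtries j t ≡ []
  subtries-< {h} {j} t h<j with h ℕ.≟ j
  ... | yes ≡.refl = ⊥-elim (ℕ.<-irrefl ≡.refl h<j)
  subtries-< (leaf _)   h<j | no _ = ≡.refl
  subtries-< (node l r) h<j | no _ = ≡.cong₂ _++_ (subtries-< l (ℕ.<⇒≤ h<j)) (subtries-< r (ℕ.<⇒≤ h<j))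

  subtries-self : ∀ {h} (t : Trie A h) → subtries h t ≡ t ∷ []
  subtries-self {h} t with h ℕ.≟ h
  ... | no h≢h = ⊥-elim (h≢h ≡.refl)
  subtries-self (leaf _)   | yes ≡.refl = ≡.refl
  subtries-self (node l r) | yes ≡.refl =
    ≡.cong (_ ∷_) (≡.cong₂ _++_ (subtries-< l ℕ.≤-refl) (subtries-< r ℕ.≤-refl))

  subtries-node : ∀ {h j} (l r : Trie A h) → j ℕ.≤ h →
                  subtries j (node l r) ≡ subtries j l ++ subtries j r
  subtries-node {h} {j} l r j≤h with suc h ℕ.≟ j
  ... | yes ≡.refl = ⊥-elim (ℕ.<-irrefl ≡.refl j≤h)
  ... | no  _      = ≡.refl

  leaf-injective : ∀ {a b : A} → leaf a ≡ leaf b → a ≡ b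
  leaf-injective ≡.refl = ≡.refl

  node-injective : ∀ {h} {l l′ r r′ : Trie A h} → node l r ≡ node l′ r′ → l ≡ l′ × r ≡ r′
  node-injective ≡.refl = ≡.refl , ≡.refl

-- Expectations over random tries and the entropy of a subtrie

module RandomTries (ℝ : Reals) {δ : ℕ} (p : Fin δ → Reals.Carrier ℝ)
                   (dist : Random.IsDistribution ℝ p) where

  open Reals ℝ
  open Random ℝ p
  open RealProperties ℝ
  open LogProperties ℝ
  open ListSums ℝ
  open import Algebra.Construct.NaturalChoice.Min totalOrder using (⊓-glb; x⊓y≤x)
  open import Algebra.Solver.Ring.NaturalCoefficients.Default commutativeSemiring
    using (solve; con; _:=_; _:+_; _:*_)
  open IsDistribution dist

  private
    T : ℕ → Set
    T = Trie (Fin δ)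

    _≟ᵀ_ : ∀ {h} → DecidableEquality (T h)
    _≟ᵀ_ = _≟_ Fin._≟_

  ∈-allTries : ∀ {h} (t : T h) → t ∈ allTries h
  ∈-allTries (leaf o)   = ∈-map⁺ leaf (∈-allFin o)
  ∈-allTries (node l r) = ∈-cartesianProductWith⁺ node (∈-allTries l) (∈-allTries r)

  allTries-unique : ∀ h → Unique (allTries h)
  allTries-unique zero    = map⁺ leaf-injective (allFin⁺ δ)
  allTries-unique (suc h) = cartesianProductWith⁺ node node-injective
    (allTries-unique h) (allTries-unique h)

  length-allTries : ∀ h → length (allTries h) ≡ δ ℕ.^ (2 ℕ.^ h)
  length-allTries zero    = ≡.trans (List.length-map leaf (allFin δ))
    (≡.trans (List.length-tabulate id) (≡.sym (ℕ.^-identityʳ δ)))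
  length-allTries (suc h) = ≡.trans (length-cartesianProductWith node (allTries h) (allTries h))
    (≡.trans (≡.cong₂ ℕ._*_ (length-allTries h) (length-allTries h))
    (≡.trans (≡.sym (ℕ.^-distribˡ-+-* δ (2 ℕ.^ h) (2 ℕ.^ h)))
    (≡.cong (λ n → δ ℕ.^ (2 ℕ.^ h ℕ.+ n)) (≡.sym (ℕ.+-identityʳ _)))))

  p≤1 : ∀ o → p o ≤ 1#
  p≤1 o = begin
    p o           ≤⟨ ∈⇒≤∑ nonNegative (∈-allFin o) ⟩
    ∑ (allFin δ) p ≈⟨ ∑-allFin p ⟩
    sum p         ≈⟨ sum≈1 ⟩
    1#            ∎

  0≤probability : ∀ {h} (t : T h) → 0# ≤ probability t
  0≤probability (leaf o)   = nonNegative o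
  0≤probability (node l r) = *-nonNeg (0≤probability l) (0≤probability r)

  probability≤1 : ∀ {h} (t : T h) → probability t ≤ 1#
  probability≤1 (leaf o)   = p≤1 o
  probability≤1 (node l r) = ≤-trans
    (*-mono-≤ 0≤1 (0≤probability r) (probability≤1 l) (probability≤1 r))
    (≤-reflexive (*-identityˡ 1#))

  𝔼-cong : ∀ {h} {X Y : T h → Carrier} → (∀ t → X t ≈ Y t) → 𝔼 X ≈ 𝔼 Y
  𝔼-cong {h} X≈Y = ∑-cong (allTries h) λ t → *-congˡ (X≈Y t)

  𝔼-mono : ∀ {h} {X Y : T h → Carrier} → (∀ t → X t ≤ Y t) → 𝔼 X ≤ 𝔼 Y
  𝔼-mono {h} X≤Y = ∑-mono (allTries h) λ t → *-monoʳ-≤ (0≤probability t) (X≤Y t)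

  𝔼-+ : ∀ {h} (X Y : T h → Carrier) → 𝔼 (λ t → X t + Y t) ≈ 𝔼 X + 𝔼 Y
  𝔼-+ {h} X Y = trans (∑-cong (allTries h) λ t → distribˡ (probability t) (X t) (Y t))
    (∑-+ (allTries h) (λ t → probability t * X t) (λ t → probability t * Y t))

  𝔼-*ˡ : ∀ {h} c (X : T h → Carrier) → 𝔼 (λ t → c * X t) ≈ c * 𝔼 X
  𝔼-*ˡ {h} c X = trans
    (∑-cong (allTries h) λ t → solve 3 (λ a b c → a :* (b :* c)
        := b :* (a :* c)) refl (probability t) c (X t))
    (sym (∑-distribˡ (allTries h) c (λ t → probability t * X t)))

  𝔼-∑ : ∀ {h} {A : Set} (xs : List A) (X : A → T h → Carrier) →
        𝔼 (λ t → ∑ xs (λ x → X x t)) ≈ ∑ xs (λ x → 𝔼 (X x))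
  𝔼-∑ {h} xs X = trans
    (∑-cong (allTries h) λ t → ∑-distribˡ xs (probability t) (λ x → X x t))
    (∑-swap (allTries h) xs (λ t x → probability t * X x t))

  𝔼-leaf : ∀ (X : T 0 → Carrier) → 𝔼 X ≈ sum (λ o → p o * X (leaf o))
  𝔼-leaf X = trans (∑-map leaf (allFin δ) (λ t → probability t * X t))
    (∑-allFin (λ o → p o * X (leaf o)))

  𝔼-node : ∀ {h} (X : T (suc h) → Carrier) → 𝔼 X ≈ 𝔼 (λ l → 𝔼 (λ r → X (node l r)))
  𝔼-node {h} X = trans
    (∑-cartesianProductWith node (allTries h) (allTries h) (λ t → probability t * X t))
    (∑-cong (allTries h) λ l → trans
      (∑-cong (allTries h) λ r → *-assoc (probability l) (probability r) (X (node l r)))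
      (sym (∑-distribˡ (allTries h) (probability l) (λ r → probability r * X (node l r)))))

  ∑-probability : ∀ h → ∑ (allTries h) probability ≈ 1#
  ∑-probability zero    = trans (∑-map leaf (allFin δ) probability) (trans (∑-allFin p) sum≈1)
  ∑-probability (suc h) = begin-equality
    ∑ (allTries (suc h)) probability
      ≈⟨ ∑-cartesianProductWith node (allTries h) (allTries h) probability ⟩
    ∑ (allTries h) (λ l → ∑ (allTries h) (λ r → probability l * probability r))
      ≈⟨ ∑-cong (allTries h) (λ l → trans (sym (∑-distribˡ (allTries h) (probability l) probability))
           (trans (*-congˡ (∑-probability h)) (*-identityʳ _))) ⟩
    ∑ (allTries h) probability
      ≈⟨ ∑-probability h ⟩
    1# ∎

  𝔼-const : ∀ h c → 𝔼 {h} (λ _ → c) ≈ c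
  𝔼-const h c = begin-equality
    𝔼 {h} (λ _ → c)                           ≈⟨ ∑-cong (allTries h) (λ t → *-comm (probability t) c) ⟩
    ∑ (allTries h) (λ t → c * probability t)  ≈⟨ ∑-distribˡ (allTries h) c probability ⟨
    c * ∑ (allTries h) probability            ≈⟨ *-congˡ (∑-probability h) ⟩
    c * 1#                                    ≈⟨ *-identityʳ c ⟩
    c                                         ∎

  -- Each child of a random trie is distributed as a random trie of height h. This one doubling
  -- serves both the sums over subtries and the surprisal.
  𝔼-node-+ : ∀ {h} {X : T (suc h) → Carrier} (Y : T h → Carrier) →
             (∀ l r → X (node l r) ≈ Y l + Y r) → 𝔼 X ≈ ι 2 * 𝔼 Y
  𝔼-node-+ {h} {X} Y X≈ = begin-equality
    𝔼 X                                 ≈⟨ 𝔼-node X ⟩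
    𝔼 (λ l → 𝔼 (λ r → X (node l r)))
      ≈⟨ 𝔼-cong (λ l → trans (𝔼-cong (X≈ l)) (trans (𝔼-+ (λ _ → Y l) Y) (+-congʳ (𝔼-const h (Y l))))) ⟩
    𝔼 (λ l → Y l + 𝔼 Y)                 ≈⟨ 𝔼-+ Y (λ _ → 𝔼 Y) ⟩
    𝔼 Y + 𝔼 {h} (λ _ → 𝔼 Y)             ≈⟨ +-congˡ (𝔼-const h (𝔼 Y)) ⟩
    𝔼 Y + 𝔼 Y
      ≈⟨ solve 1 (λ x → x :+ x := (con 1 :+ (con 1 :+ con 0)) :* x) refl (𝔼 Y) ⟩
    ι 2 * 𝔼 Y                           ∎

  -- There are 2ᵈ nodes at level j, each the root of a random trie of height j. Writing the height
  -- as d + j lets recursion on d remove one `node` at a time.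
  𝔼-∑-subtries : ∀ d j (f : T j → Carrier) → 𝔼 {d ℕ.+ j} (λ t → ∑ (subtries j t) f) ≈ ι 2 ^ d * 𝔼 f
  𝔼-∑-subtries zero    j f = trans
    (𝔼-cong λ t → trans (reflexive (≡.cong (λ ts → ∑ ts f) (subtries-self t))) (+-identityʳ (f t)))
    (sym (*-identityˡ (𝔼 f)))
  𝔼-∑-subtries (suc d) j f = begin-equality
    𝔼 {suc d ℕ.+ j} (λ t → ∑ (subtries j t) f)
      ≈⟨ 𝔼-node-+ (λ t → ∑ (subtries j t) f) (λ l r → trans
           (reflexive (≡.cong (λ ts → ∑ ts f) (subtries-node l r (ℕ.m≤n+m j d))))
           (∑-++ (subtries j l) (subtries j r) f)) ⟩
    ι 2 * 𝔼 {d ℕ.+ j} (λ t → ∑ (subtries j t) f)   ≈⟨ *-congˡ (𝔼-∑-subtries d j f) ⟩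
    ι 2 * (ι 2 ^ d * 𝔼 f)                           ≈⟨ *-assoc _ _ _ ⟨
    ι 2 ^ suc d * 𝔼 f                               ∎

  -- Stands in for log₂ (1 / probability), being additive by definition. At a leaf with p o = 0 the
  -- value is arbitrary, but it is only averaged with weight 0.
  surprisal : ∀ {h} → T h → Carrier
  surprisal (leaf o)   = log₂ (p o ⁻¹)
  surprisal (node l r) = surprisal l + surprisal r

  𝔼-surprisal : ∀ h → 𝔼 {h} surprisal ≈ ι 2 ^ h * entropy
  𝔼-surprisal zero    = trans (𝔼-leaf surprisal) (sym (*-identityˡ entropy))
  𝔼-surprisal (suc h) = trans (𝔼-node-+ {h} {surprisal} surprisal (λ l r → refl))
    (trans (*-congˡ (𝔼-surprisal h)) (sym (*-assoc _ _ _)))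

  entropy-nonNeg : 0# ≤ entropy
  entropy-nonNeg = ≤-trans (∑-nonNeg (allFin δ) 0≤summand) (≤-reflexive (∑-allFin (λ o → p o * log₂ (p o ⁻¹))))
    where
    0≤summand : ∀ o → 0# ≤ p o * log₂ (p o ⁻¹)
    0≤summand o with nonNegative o
    ... | inj₁ 0<po = *-nonNeg (inj₁ 0<po) (0≤log₂ (1≤x⁻¹ 0<po (p≤1 o)))
    ... | inj₂ 0≈po = ≤-reflexive (sym (trans (*-congʳ (sym 0≈po)) (zeroˡ _)))

  -- Subadditivity of log₂, applied at every node. Positivity of the product passes to both factors,
  -- so all the inverses are genuine and at least 1.
  log₂-probability⁻¹≤surprisal : ∀ {h} (t : T h) → 0# < probability t →
                                 log₂ (probability t ⁻¹) ≤ surprisal t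
  log₂-probability⁻¹≤surprisal (leaf o)   _    = ≤-refl
  log₂-probability⁻¹≤surprisal (node l r) 0<lr = ≤-trans
    (log₂-≤-+ (1≤x⁻¹ 0<l (probability≤1 l)) (1≤x⁻¹ 0<r (probability≤1 r))
      (1≤x⁻¹ 0<lr (probability≤1 (node l r)))
      (*-cancelˡ-≤ 0<lr (begin
        L * R * (L * R) ⁻¹          ≈⟨ x*x⁻¹≈1 0<lr ⟩
        1#                          ≈⟨ *-identityˡ 1# ⟨
        1# * 1#                     ≈⟨ *-cong (x*x⁻¹≈1 0<l) (x*x⁻¹≈1 0<r) ⟨
        (L * L ⁻¹) * (R * R ⁻¹)
          ≈⟨ solve 4 (λ a b c d → (a :* b) :* (c :* d) := a :* c :* (b :* d)) refl L (L ⁻¹) R (R ⁻¹) ⟩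
        L * R * (L ⁻¹ * R ⁻¹)       ∎)))
    (+-mono-≤ (log₂-probability⁻¹≤surprisal l 0<l) (log₂-probability⁻¹≤surprisal r 0<r))
    where
    L = probability l
    R = probability r
    pos : ∀ {x y} → 0# ≤ x → 0# < x * y → 0# < x
    pos (inj₁ 0<x) _ = 0<x
    pos {x} {y} (inj₂ 0≈x) 0<xy = ⊥-elim (<⇒≱ 0<xy (≤-reflexive (trans (*-congʳ (sym 0≈x)) (zeroˡ y))))
    0<l = pos (0≤probability l) 0<lr
    0<r : 0# < R
    0<r = pos (0≤probability r) (begin-strict
      0#    <⟨ 0<lr ⟩
      L * R ≈⟨ *-comm L R ⟩
      R * L ∎)

  -- With x = q⁻¹, dividing by q turns the claim into n * min (x / 2 ^ n) 1 ≤ log₂ x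
  -- for x ≥ 2; the second summand absorbs the values q > 1/2.
  truncated-≤ : ∀ {q w G} n → 0# < q → q ≤ 1# → log₂ (q ⁻¹) ≤ G → w ≤ 1# → w ≤ ι 2 ^ n * q →
                ι n * w ≤ ι 2 ^ n * (q * G) + ι 2 * (ι n * q)
  truncated-≤ {q} {w} {G} n 0<q q≤1 logx≤G w≤1 w≤2ⁿq with ι 2 ≤? q ⁻¹
  ... | no 2≰x = begin
    ι n * w                  ≤⟨ *-monoʳ-≤ (0≤ι n) w≤1 ⟩
    ι n * 1#                 ≈⟨ *-congˡ (x*x⁻¹≈1 0<q) ⟨
    ι n * (q * q ⁻¹)         ≤⟨ *-monoʳ-≤ (0≤ι n) (*-monoʳ-≤ (inj₁ 0<q) (inj₁ (≰⇒> 2≰x))) ⟩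
    ι n * (q * ι 2)          ≈⟨ solve 3 (λ n q t → n :* (q :* t) := t :* (n :* q)) refl (ι n) q (ι 2) ⟩
    ι 2 * (ι n * q)          ≤⟨ x≤x+y (*-nonNeg (^-nonNeg n 0≤2) (*-nonNeg (inj₁ 0<q) 0≤G)) ⟩
    ι 2 * (ι n * q) + ι 2 ^ n * (q * G) ≈⟨ +-comm _ _ ⟩
    ι 2 ^ n * (q * G) + ι 2 * (ι n * q) ∎
    where
    0≤G = ≤-trans (0≤log₂ (1≤x⁻¹ 0<q q≤1)) logx≤G
  ... | yes 2≤x = ≤-trans main (x≤x+y (*-nonNeg 0≤2 (*-nonNeg (0≤ι n) (inj₁ 0<q))))
    where
    main : ι n * w ≤ ι 2 ^ n * (q * G)
    main with n⊓n*x/2^n≤log₂x n 2≤x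
    ... | inj₁ n≤logx = begin
      ι n * w              ≤⟨ *-monoʳ-≤ (0≤ι n) w≤2ⁿq ⟩
      ι n * (ι 2 ^ n * q)  ≈⟨ solve 3 (λ n p q → n :* (p :* q) := p :* (q :* n)) refl (ι n) (ι 2 ^ n) q ⟩
      ι 2 ^ n * (q * ι n)  ≤⟨ *-monoʳ-≤ (^-nonNeg n 0≤2) (*-monoʳ-≤ (inj₁ 0<q) (≤-trans n≤logx logx≤G)) ⟩
      ι 2 ^ n * (q * G)    ∎
    ... | inj₂ nx≤2ⁿlogx = begin
      ι n * w                   ≤⟨ *-monoʳ-≤ (0≤ι n) w≤1 ⟩
      ι n * 1#                  ≈⟨ *-congˡ (x*x⁻¹≈1 0<q) ⟨
      ι n * (q * q ⁻¹)          ≈⟨ solve 3 (λ n q x → n :* (q :* x) := q :* (n :* x)) refl (ι n) q (q ⁻¹) ⟩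
      q * (ι n * q ⁻¹)
        ≤⟨ *-monoʳ-≤ (inj₁ 0<q) (≤-trans nx≤2ⁿlogx (*-monoʳ-≤ (^-nonNeg n 0≤2) logx≤G)) ⟩
      q * (ι 2 ^ n * G)         ≈⟨ solve 3 (λ n q x → n :* (q :* x) := q :* (n :* x)) refl q (ι 2 ^ n) G ⟩
      ι 2 ^ n * (q * G)         ∎

  -- Expected number of distinct subtries at one level

  module _ (d j : ℕ) where

    open Counting (_≟ᵀ_ {j})

    private
      h = d ℕ.+ j

      distinct : T h → List (T j)
      distinct t = deduplicate _≟ᵀ_ (subtries j t)

    -- As `distinct t` has no repetitions, the count is an indicator, and this is the probability
    -- that s occurs at level j.
    occurrence : T j → Carrier
    occurrence s = 𝔼 {h} λ t → count s (distinct t)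

    expectedWidth≤∑-occurrence : expectedWidth h j ≤ ∑ (allTries j) occurrence
    expectedWidth≤∑-occurrence = ≤-trans
      (𝔼-mono {h} λ t → length≤∑-count ∈-allTries (distinct t))
      (≤-reflexive (𝔼-∑ (allTries j) (λ s t → count s (distinct t))))

    occurrence≤1 : ∀ s → occurrence s ≤ 1#
    occurrence≤1 s = ≤-trans
      (𝔼-mono {h} λ t → count-unique s (deduplicate-! _≟ᵀ_ (subtries j t)))
      (≤-reflexive (𝔼-const h 1#))

    -- The union bound over the 2ᵈ nodes of level j, each of which carries s with probability
    -- `probability s`.
    occurrence≤2^d*probability : ∀ s → occurrence s ≤ ι 2 ^ d * probability s
    occurrence≤2^d*probability s = begin
      occurrence s
        ≤⟨ 𝔼-mono {h} (λ t → ∑-deduplicate-≤ _≟ᵀ_ (subtries j t) (𝟙-nonNeg s)) ⟩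
      𝔼 {h} (λ t → count s (subtries j t))     ≈⟨ 𝔼-∑-subtries d j 𝟙[ s ≡_] ⟩
      ι 2 ^ d * 𝔼 𝟙[ s ≡_]                     ≤⟨ *-monoʳ-≤ (^-nonNeg d 0≤2) (begin
        𝔼 𝟙[ s ≡_]                               ≈⟨ ∑-cong (allTries j) (*-𝟙-subst probability s) ⟩
        ∑ (allTries j) (λ t → probability s * 𝟙[ s ≡ t ])
          ≈⟨ ∑-distribˡ (allTries j) (probability s) 𝟙[ s ≡_] ⟨
        probability s * count s (allTries j)
          ≤⟨ *-monoʳ-≤ (0≤probability s) (count-unique s (allTries-unique j)) ⟩
        probability s * 1#                       ≈⟨ *-identityʳ _ ⟩
        probability s                            ∎) ⟩
      ι 2 ^ d * probability s                  ∎

    expectedWidth≤2^d : expectedWidth h j ≤ ι (2 ℕ.^ d)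
    expectedWidth≤2^d = begin
      expectedWidth h j                               ≤⟨ expectedWidth≤∑-occurrence ⟩
      ∑ (allTries j) occurrence                       ≤⟨ ∑-mono (allTries j) occurrence≤2^d*probability ⟩
      ∑ (allTries j) (λ s → ι 2 ^ d * probability s)  ≈⟨ ∑-distribˡ (allTries j) (ι 2 ^ d) probability ⟨
      ι 2 ^ d * ∑ (allTries j) probability            ≈⟨ *-congˡ (∑-probability j) ⟩
      ι 2 ^ d * 1#                                    ≈⟨ *-identityʳ _ ⟩
      ι 2 ^ d                                         ≈⟨ ι-^ 2 d ⟨
      ι (2 ℕ.^ d)                                     ∎

    expectedWidth≤δ^2^j : expectedWidth h j ≤ ι (δ ℕ.^ (2 ℕ.^ j))
    expectedWidth≤δ^2^j = begin
      expectedWidth h j             ≤⟨ expectedWidth≤∑-occurrence ⟩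
      ∑ (allTries j) occurrence     ≤⟨ ∑-mono (allTries j) occurrence≤1 ⟩
      ∑ (allTries j) (λ _ → 1#)     ≈⟨ ∑-1 (allTries j) ⟩
      ι (length (allTries j))       ≡⟨ ≡.cong ι (length-allTries j) ⟩
      ι (δ ℕ.^ (2 ℕ.^ j))           ∎

    d*occurrence-≤ : ∀ s → ι d * occurrence s ≤
                     ι 2 ^ d * (probability s * surprisal s) + ι 2 * (ι d * probability s)
    d*occurrence-≤ s with 0≤probability s
    ... | inj₁ 0<q = truncated-≤ d 0<q (probability≤1 s) (log₂-probability⁻¹≤surprisal s 0<q)
      (occurrence≤1 s) (occurrence≤2^d*probability s)
    -- The inverse of q = 0 is unspecified, but the union bound already gives an occurrence of at
    -- most 0.
    ... | inj₂ 0≈q = begin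
      ι d * occurrence s                ≤⟨ *-monoʳ-≤ (0≤ι d) (occurrence≤2^d*probability s) ⟩
      ι d * (ι 2 ^ d * probability s)   ≈⟨ *-congˡ (*-congˡ 0≈q) ⟨
      ι d * (ι 2 ^ d * 0#)
        ≈⟨ solve 3 (λ n p g → n :* (p :* con 0)
            := p :* (con 0 :* g) :+ (con 1 :+ (con 1 :+ con 0)) :* (n :* con 0)) refl (ι d) (ι 2 ^ d) (surprisal s) ⟩
      ι 2 ^ d * (0# * surprisal s) + ι 2 * (ι d * 0#)
        ≈⟨ +-cong (*-congˡ (*-congʳ 0≈q)) (*-congˡ (*-congˡ 0≈q)) ⟩
      ι 2 ^ d * (probability s * surprisal s) + ι 2 * (ι d * probability s) ∎

    -- Kept multiplied by d, so that d = 0 is no exception. The factor 2ʲ from the entropy of a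
    -- subtrie completes 2ᵈ to 2ʰ.
    d*expectedWidth-≤ : ι d * expectedWidth h j ≤ ι (2 ℕ.^ h) * entropy + ι 2 * ι d
    d*expectedWidth-≤ = begin
      ι d * expectedWidth h j                  ≤⟨ *-monoʳ-≤ (0≤ι d) expectedWidth≤∑-occurrence ⟩
      ι d * ∑ (allTries j) occurrence          ≈⟨ ∑-distribˡ (allTries j) (ι d) occurrence ⟩
      ∑ (allTries j) (λ s → ι d * occurrence s) ≤⟨ ∑-mono (allTries j) d*occurrence-≤ ⟩
      ∑ (allTries j) (λ s → ι 2 ^ d * (probability s * surprisal s) + ι 2 * (ι d * probability s))
        ≈⟨ ∑-+ (allTries j) (λ s → ι 2 ^ d * (probability s * surprisal s)) (λ s → ι 2 * (ι d * probability s)) ⟩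
      ∑ (allTries j) (λ s → ι 2 ^ d * (probability s * surprisal s)) + ∑ (allTries j) (λ s → ι 2 * (ι d * probability s))
        ≈⟨ +-cong (∑-distribˡ (allTries j) (ι 2 ^ d) (λ s → probability s * surprisal s))
             (trans (*-congˡ (∑-distribˡ (allTries j) (ι d) probability)) (∑-distribˡ (allTries j) (ι 2) (λ s → ι d * probability s))) ⟨
      ι 2 ^ d * 𝔼 {j} surprisal + ι 2 * (ι d * ∑ (allTries j) probability)
        ≈⟨ +-cong (*-congˡ (𝔼-surprisal j)) (*-congˡ
            (trans (*-congˡ (∑-probability j)) (*-identityʳ (ι d)))) ⟩
      ι 2 ^ d * (ι 2 ^ j * entropy) + ι 2 * ι d
        ≈⟨ +-congʳ (trans (sym (*-assoc _ _ _)) (*-congʳ (trans (sym (^-homo-* (ι 2) d j)) (sym (ι-^ 2 h))))) ⟩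
      ι (2 ℕ.^ h) * entropy + ι 2 * ι d ∎

  -- Comparison with β and the storage bound

  β-top : ∀ h j → h ℕ.∸ j ≡ 0 → β h j ≡ ι (2 ℕ.^ (h ℕ.∸ j)) ⊓ ι (δ ℕ.^ (2 ℕ.^ j))
  β-top h j eq rewrite eq = ≡.refl

  -- `β` branches on `h ∸ j`, which is in general not in constructor form; an equation for it
  -- selects the branch.
  β-below : ∀ h j m → h ℕ.∸ j ≡ suc m →
    β h j ≡ (entropy * ι (suc m) ⁻¹ * ι (2 ℕ.^ h) + ι 3) ⊓ (ι (2 ℕ.^ (h ℕ.∸ j)) ⊓ ι (δ ℕ.^ (2 ℕ.^ j)))
  β-below h j m eq rewrite eq = ≡.refl

  expectedWidth≤β : ∀ d j → expectedWidth (d ℕ.+ j) j ≤ β (d ℕ.+ j) j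
  expectedWidth≤β d j = helper d ≡.refl
    where
    h = d ℕ.+ j
    h∸j≡d : h ℕ.∸ j ≡ d
    h∸j≡d = ℕ.m+n∸n≡m d j
    ≤⊓ : expectedWidth h j ≤ ι (2 ℕ.^ (h ℕ.∸ j)) ⊓ ι (δ ℕ.^ (2 ℕ.^ j))
    ≤⊓ = ⊓-glb (≤-trans (expectedWidth≤2^d d j) (≤-reflexive (reflexive (≡.cong (λ n → ι (2 ℕ.^ n)) (≡.sym h∸j≡d)))))
               (expectedWidth≤δ^2^j d j)
    helper : ∀ n → d ≡ n → expectedWidth h j ≤ β h j
    helper zero    d≡0 = ≤-trans ≤⊓ (≤-reflexive (reflexive (≡.sym (β-top h j (≡.trans h∸j≡d d≡0)))))
    helper (suc m) ≡.refl = ≤-trans (⊓-glb ≤entropy ≤⊓) (≤-reflexive (reflexive (≡.sym (β-below h j m h∸j≡d))))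
      where
      n = ι (suc m)
      ≤entropy : expectedWidth h j ≤ entropy * n ⁻¹ * ι (2 ℕ.^ h) + ι 3
      ≤entropy = *-cancelˡ-≤ (0<ι m) (begin
        n * expectedWidth h j                       ≤⟨ d*expectedWidth-≤ (suc m) j ⟩
        ι (2 ℕ.^ h) * entropy + ι 2 * n
          -- The correction for q > 1/2 yields the constant 2, weakened here to the 3 of `β`.
          ≤⟨ +-monoʳ-≤ _ (*-monoˡ-≤ (0≤ι (suc m)) (ι-mono {2} {3} (s≤s (s≤s z≤n)))) ⟩
        ι (2 ℕ.^ h) * entropy + ι 3 * n
          ≈⟨ +-congʳ (trans (*-congʳ (x*x⁻¹≈1 (0<ι m))) (*-identityˡ _)) ⟨
        n * n ⁻¹ * (ι (2 ℕ.^ h) * entropy) + ι 3 * n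
          ≈⟨ solve 5 (λ n i a e t → n :* i :* (a :* e) :+ t :* n
              := n :* (e :* i :* a :+ t)) refl n (n ⁻¹) (ι (2 ℕ.^ h)) entropy (ι 3) ⟩
        n * (entropy * n ⁻¹ * ι (2 ℕ.^ h) + ι 3)    ∎)

  expectedStorage≈ : ∀ h b →
    expectedStorage h b ≈ ι (2 ℕ.* b) * sum (λ (i : Fin h) → expectedWidth h (suc (toℕ i)))
  expectedStorage≈ h b = begin-equality
    expectedStorage h b
      ≈⟨ 𝔼-cong (λ t → trans (ι-sum (allFin h) (λ i → width t i ℕ.* (2 ℕ.* b)))
           (∑-cong (allFin h) (λ i → trans (ι-* (width t i) (2 ℕ.* b)) (*-comm _ _)))) ⟩
    𝔼 (λ t → ∑ (allFin h) (λ i → ι (2 ℕ.* b) * ι (width t i)))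
      ≈⟨ 𝔼-∑ (allFin h) (λ i t → ι (2 ℕ.* b) * ι (width t i)) ⟩
    ∑ (allFin h) (λ i → 𝔼 (λ t → ι (2 ℕ.* b) * ι (width t i)))
      ≈⟨ ∑-cong (allFin h) (λ i → 𝔼-*ˡ (ι (2 ℕ.* b)) (λ t → ι (width t i))) ⟩
    ∑ (allFin h) (λ i → ι (2 ℕ.* b) * expectedWidth h (suc (toℕ i)))
      ≈⟨ ∑-distribˡ (allFin h) (ι (2 ℕ.* b)) (λ i → expectedWidth h (suc (toℕ i))) ⟨
    ι (2 ℕ.* b) * ∑ (allFin h) (λ i → expectedWidth h (suc (toℕ i)))
      ≈⟨ *-congˡ (∑-allFin {h} (λ i → expectedWidth h (suc (toℕ i)))) ⟩
    ι (2 ℕ.* b) * sum (λ (i : Fin h) → expectedWidth h (suc (toℕ i))) ∎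
    where
    width : T h → Fin h → ℕ
    width t i = DAG.width (foldTrie t) (suc (toℕ i))

  storage-≤ : ∀ h k → k ℕ.≤ h → (∀ j → 1 ℕ.≤ j → j ℕ.≤ h → β h j ≤ β h k) →
    ι (2 ℕ.* (h ℕ.∸ k)) * sum (λ (i : Fin h) → expectedWidth h (suc (toℕ i)))
      ≤ ι 2 * ι h * entropy * ι (2 ℕ.^ h) + ι (6 ℕ.* h ℕ.^ 2)
  storage-≤ h k k≤h maximal = helper (h ℕ.∸ k) ≡.refl
    where
    W = sum (λ (i : Fin h) → expectedWidth h (suc (toℕ i)))
    rhs = ι 2 * ι h * entropy * ι (2 ℕ.^ h) + ι (6 ℕ.* h ℕ.^ 2)
    W≤ : W ≤ ι h * β h k
    W≤ = sum-≤-const (β h k) λ i →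
      let j = suc (toℕ i)
          j≤h = Fin.toℕ<n i
      in ≤-trans (≡.subst (λ h → expectedWidth h j ≤ β h j) (ℕ.m∸n+n≡m j≤h) (expectedWidth≤β (h ℕ.∸ j) j))
           (maximal j (s≤s z≤n) j≤h)
    helper : ∀ n → h ℕ.∸ k ≡ n → ι (2 ℕ.* n) * W ≤ rhs
    -- For k = h the entropy term is absent from `β h k`, but the pointers then have 0 bits.
    helper zero    _  = begin
      0# * W ≈⟨ zeroˡ W ⟩
      0#
        ≤⟨ +-nonNeg (*-nonNeg (*-nonNeg (*-nonNeg 0≤2 (0≤ι h)) entropy-nonNeg) (0≤ι (2 ℕ.^ h))) (0≤ι (6 ℕ.* h ℕ.^ 2)) ⟩
      rhs    ∎
    helper (suc m) eq = begin
      ι (2 ℕ.* suc m) * W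
        ≤⟨ *-monoʳ-≤ (0≤ι (2 ℕ.* suc m)) (≤-trans W≤ (*-monoʳ-≤ (0≤ι h) βk≤)) ⟩
      ι (2 ℕ.* suc m) * (ι h * (entropy * n ⁻¹ * N + ι 3))   ≈⟨ *-congʳ (ι-* 2 (suc m)) ⟩
      ι 2 * n * (ι h * (entropy * n ⁻¹ * N + ι 3))
        ≈⟨ solve 7 (λ t n h e i N s → t :* n :* (h :* (e :* i :* N :+ s))
            := t :* h :* e :* N :* (n :* i) :+ t :* s :* (n :* h)) refl (ι 2) n (ι h) entropy (n ⁻¹) N (ι 3) ⟩
      ι 2 * ι h * entropy * N * (n * n ⁻¹) + ι 2 * ι 3 * (n * ι h)
        ≈⟨ +-congʳ (trans (*-congˡ (x*x⁻¹≈1 (0<ι m))) (*-identityʳ _)) ⟩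
      ι 2 * ι h * entropy * N + ι 2 * ι 3 * (n * ι h)
        -- The 6 is two pointers times the 3 of `β`; with n = h - k ≤ h, the product 6 n h is at
        -- most 6 h².
        ≈⟨ +-congˡ (trans (ι-* 6 (suc m ℕ.* h)) (*-cong (ι-* 2 3) (ι-* (suc m) h))) ⟨
      ι 2 * ι h * entropy * N + ι (6 ℕ.* (suc m ℕ.* h))
        ≤⟨ +-monoʳ-≤ _ (ι-mono (ℕ.*-monoʳ-≤ 6
            (ℕ.≤-trans (ℕ.*-monoˡ-≤ h 1+m≤h) (ℕ.≤-reflexive (≡.cong (h ℕ.*_) (≡.sym (ℕ.*-identityʳ h))))))) ⟩
      rhs ∎
      where
      n = ι (suc m)
      N = ι (2 ℕ.^ h)
      1+m≤h : suc m ℕ.≤ h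
      1+m≤h = ≡.subst (ℕ._≤ h) eq (ℕ.m∸n≤m h k)
      βk≤ : β h k ≤ entropy * n ⁻¹ * N + ι 3
      βk≤ = ≤-trans (≤-reflexive (reflexive (β-below h k m eq))) (x⊓y≤x _ _)

theorem1 : (ℝ : Reals) → let open Reals ℝ in
    (h : ℕ) → 2 ℕ.≤ h →
    (δ : ℕ) (p : Fin δ → Carrier) → let open Random ℝ p in
    IsDistribution →
    (k : ℕ) → 1 ℕ.≤ k → k ℕ.≤ h →
    (∀ j → 1 ℕ.≤ j → j ℕ.≤ h → β h j ≤ β h k) →
    let S = ι (2 ℕ.* (h ℕ.∸ k)) * sum (λ (i : Fin h) → expectedWidth h (ℕ.suc (toℕ i))) in
    (expectedStorage h (h ℕ.∸ k) ≈ S) ×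
    (S ≤ ι 2 * ι h * entropy * ι (2 ℕ.^ h) + ι (6 ℕ.* h ℕ.^ 2))
theorem1 ℝ h _ δ p dist k _ k≤h maximal = expectedStorage≈ h (h ℕ.∸ k) , storage-≤ h k k≤h maximal
  where open RandomTries ℝ p dist
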